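{- There exist continuum many positive transcendental real numbers $\sigma$ with the following property: for every integer $m\ge2$ and every Liouville number $\xi$, the number $\sigma\xi^m$ is a Liouville number.
   Context: A real number $\xi$ is a Liouville number if for every integer $N\ge 1$ there exist infinitely many pairs $(p,q)\in\mathbb{Z}\times\mathbb{Z}_{>0}$ with $q\ge 2$ such that $0<|\xi-p/q|<q^{ -N}$. "Continuum many" means that the set of such $\sigma$ has the cardinality of $\mathbb{R}$. -}

module Defs where

open import Data.Integer.Base as ℤ using (ℤ; 0ℤ)
open import Data.List.Base using (List; []; _∷_)
open import Data.List.Membership.Propositional using (_∉_)
open import Data.List.Relation.Unary.Any using (Any)
open import Data.Nat.Base as ℕ using (ℕ; zero; suc)
import Data.Nat.Properties as ℕ
open import Data.Product.Base using (Σ; ∃; ∃-syntax; _×_; _,_; proj₁; proj₂)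
open import Data.Rational.Base as ℚ using (ℚ; 0ℚ; 1ℚ; ½)
import Data.Rational.Properties as ℚ
open import Data.Sum.Base using (inj₁; inj₂)
open import Function.Bundles using (Bijection)
open import Level using (0ℓ)
open import Relation.Binary.Bundles using (Setoid)
import Relation.Binary.Construct.On as On
open import Relation.Binary.PropositionalEquality
open import Relation.Nullary.Decidable.Core using (dec⇒maybe)
open import Relation.Nullary.Negation.Core using (¬_)
open import Tactic.RingSolver using (solve-∀)
open import Tactic.RingSolver.Core.AlmostCommutativeRing
  using (AlmostCommutativeRing; fromCommutativeRing)

private
  ℚ-ring : AlmostCommutativeRing 0ℓ 0ℓ
  ℚ-ring = fromCommutativeRing ℚ.+-*-commutativeRing (λ q → dec⇒maybe (0ℚ ℚ.≟ q))

  telescope : ∀ p q r → (p ℚ.- q) ℚ.+ (q ℚ.- r) ≡ p ℚ.- r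
  telescope = solve-∀ ℚ-ring

  p-q+q≡p : ∀ p q → (p ℚ.- q) ℚ.+ q ≡ p
  p-q+q≡p = solve-∀ ℚ-ring

  p+q-q≡p : ∀ p q → (p ℚ.+ q) ℚ.- q ≡ p
  p+q-q≡p = solve-∀ ℚ-ring

  +-interchange-- : ∀ a b c d → (a ℚ.- c) ℚ.+ (b ℚ.- d) ≡ (a ℚ.+ b) ℚ.- (c ℚ.+ d)
  +-interchange-- = solve-∀ ℚ-ring

  q-p≡-p--q : ∀ p q → q ℚ.- p ≡ (ℚ.- p) ℚ.- (ℚ.- q)
  q-p≡-p--q = solve-∀ ℚ-ring

  *-difference : ∀ a b c d →
    a ℚ.* (b ℚ.- d) ℚ.+ d ℚ.* (a ℚ.- c) ≡ a ℚ.* b ℚ.- c ℚ.* d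
  *-difference = solve-∀ ℚ-ring

  ½ε>0 : ∀ {ε} → 0ℚ ℚ.< ε → 0ℚ ℚ.< ½ ℚ.* ε
  ½ε>0 {ε} ε>0 = ℚ.positive⁻¹ _ {{ℚ.pos*pos⇒pos ½ ε {{ℚ.positive ε>0}}}}

  ½ε+½ε≡ε : ∀ ε → ½ ℚ.* ε ℚ.+ ½ ℚ.* ε ≡ ε
  ½ε+½ε≡ε ε = trans (sym (ℚ.*-distribʳ-+ ε ½ ½)) (ℚ.*-identityˡ ε)

  ∣p-p∣≡0 : ∀ p → ℚ.∣ p ℚ.- p ∣ ≡ 0ℚ
  ∣p-p∣≡0 p = cong ℚ.∣_∣ (ℚ.+-inverseʳ p)

  -‿flip : ∀ p q → ℚ.- (p ℚ.- q) ≡ q ℚ.- p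
  -‿flip = solve-∀ ℚ-ring

  ∣p-q∣≡∣q-p∣ : ∀ p q → ℚ.∣ p ℚ.- q ∣ ≡ ℚ.∣ q ℚ.- p ∣
  ∣p-q∣≡∣q-p∣ p q = trans (sym (ℚ.∣-p∣≡∣p∣ (p ℚ.- q))) (cong ℚ.∣_∣ (-‿flip p q))

  ∣p-r∣≤∣p-q∣+∣q-r∣ : ∀ p q r → ℚ.∣ p ℚ.- r ∣ ℚ.≤ ℚ.∣ p ℚ.- q ∣ ℚ.+ ℚ.∣ q ℚ.- r ∣
  ∣p-r∣≤∣p-q∣+∣q-r∣ p q r =
    subst (λ t → ℚ.∣ t ∣ ℚ.≤ ℚ.∣ p ℚ.- q ∣ ℚ.+ ℚ.∣ q ℚ.- r ∣)
          (telescope p q r)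
          (ℚ.∣p+q∣≤∣p∣+∣q∣ (p ℚ.- q) (q ℚ.- r))

  ∣p∣≤∣p-q∣+∣q∣ : ∀ p q → ℚ.∣ p ∣ ℚ.≤ ℚ.∣ p ℚ.- q ∣ ℚ.+ ℚ.∣ q ∣
  ∣p∣≤∣p-q∣+∣q∣ p q =
    subst (λ t → ℚ.∣ t ∣ ℚ.≤ ℚ.∣ p ℚ.- q ∣ ℚ.+ ℚ.∣ q ∣)
          (p-q+q≡p p q)
          (ℚ.∣p+q∣≤∣p∣+∣q∣ (p ℚ.- q) q)

  ∣p∣-∣q∣≤∣p-q∣ : ∀ p q → ℚ.∣ p ∣ ℚ.- ℚ.∣ q ∣ ℚ.≤ ℚ.∣ p ℚ.- q ∣
  ∣p∣-∣q∣≤∣p-q∣ p q =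
    subst (ℚ.∣ p ∣ ℚ.- ℚ.∣ q ∣ ℚ.≤_)
          (p+q-q≡p ℚ.∣ p ℚ.- q ∣ ℚ.∣ q ∣)
          (ℚ.+-monoˡ-≤ (ℚ.- ℚ.∣ q ∣) (∣p∣≤∣p-q∣+∣q∣ p q))

  ∣∣p∣-∣q∣∣≤∣p-q∣ : ∀ p q → ℚ.∣ ℚ.∣ p ∣ ℚ.- ℚ.∣ q ∣ ∣ ℚ.≤ ℚ.∣ p ℚ.- q ∣
  ∣∣p∣-∣q∣∣≤∣p-q∣ p q with ℚ.∣p∣≡p∨∣p∣≡-p (ℚ.∣ p ∣ ℚ.- ℚ.∣ q ∣)
  ... | inj₁ eq = subst (ℚ._≤ ℚ.∣ p ℚ.- q ∣) (sym eq) (∣p∣-∣q∣≤∣p-q∣ p q)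
  ... | inj₂ eq = subst₂ ℚ._≤_
          (sym (trans eq (-‿flip ℚ.∣ p ∣ ℚ.∣ q ∣))) (∣p-q∣≡∣q-p∣ q p)
          (∣p∣-∣q∣≤∣p-q∣ q p)

IsCauchy : (ℕ → ℚ) → Set
IsCauchy x = ∀ ε → 0ℚ ℚ.< ε →
  ∃[ N ] ∀ m n → N ℕ.≤ m → N ℕ.≤ n → ℚ.∣ x m ℚ.- x n ∣ ℚ.< ε

-- The real numbers are Cauchy sequences of rationals, taken up to the
-- equivalence _≈_ (difference tends to 0).
record ℝ : Set where
  constructor mkℝ
  field
    seq    : ℕ → ℚ
    cauchy : IsCauchy seq

open ℝ public

infix 4 _≈_ _<_

_≈_ : ℝ → ℝ → Set
x ≈ y = ∀ ε → 0ℚ ℚ.< ε →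
  ∃[ N ] ∀ n → N ℕ.≤ n → ℚ.∣ seq x n ℚ.- seq y n ∣ ℚ.< ε

-- The gap ε is what makes this the strict order on limits.
_<_ : ℝ → ℝ → Set
x < y = ∃[ ε ] 0ℚ ℚ.< ε ×
  ∃[ N ] ∀ n → N ℕ.≤ n → seq x n ℚ.+ ε ℚ.< seq y n

≈-refl : ∀ {x} → x ≈ x
≈-refl {x} ε ε>0 = 0 , λ n _ → subst (ℚ._< ε) (sym (∣p-p∣≡0 (seq x n))) ε>0

≈-sym : ∀ {x y} → x ≈ y → y ≈ x
≈-sym {x} {y} x≈y ε ε>0 with x≈y ε ε>0
... | N , h = N , λ n N≤n → subst (ℚ._< ε) (∣p-q∣≡∣q-p∣ (seq x n) (seq y n)) (h n N≤n)

≈-trans : ∀ {x y z} → x ≈ y → y ≈ z → x ≈ z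
≈-trans {x} {y} {z} x≈y y≈z ε ε>0
  with x≈y (½ ℚ.* ε) (½ε>0 ε>0) | y≈z (½ ℚ.* ε) (½ε>0 ε>0)
... | M , f | N , g = M ℕ.⊔ N , λ n M⊔N≤n → ℚ.≤-<-trans
  (∣p-r∣≤∣p-q∣+∣q-r∣ (seq x n) (seq y n) (seq z n))
  (subst (_ ℚ.<_) (½ε+½ε≡ε ε)
    (ℚ.+-mono-< (f n (ℕ.m⊔n≤o⇒m≤o M N M⊔N≤n)) (g n (ℕ.m⊔n≤o⇒n≤o M N M⊔N≤n))))

ℝ-setoid : Setoid 0ℓ 0ℓ
ℝ-setoid = record
  { Carrier       = ℝ
  ; _≈_           = _≈_
  ; isEquivalence = record
    { refl  = λ {x} → ≈-refl {x}
    ; sym   = λ {x} {y} → ≈-sym {x} {y}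
    ; trans = λ {x} {y} {z} → ≈-trans {x} {y} {z}
    }
  }

fromℚ : ℚ → ℝ
fromℚ q .seq    _      = q
fromℚ q .cauchy ε ε>0 = 0 , λ _ _ _ _ → subst (ℚ._< ε) (sym (∣p-p∣≡0 q)) ε>0

0ℝ 1ℝ : ℝ
0ℝ = fromℚ 0ℚ
1ℝ = fromℚ 1ℚ

private
  ∣+-difference∣≤ : ∀ a b c d →
    ℚ.∣ (a ℚ.+ b) ℚ.- (c ℚ.+ d) ∣ ℚ.≤ ℚ.∣ a ℚ.- c ∣ ℚ.+ ℚ.∣ b ℚ.- d ∣
  ∣+-difference∣≤ a b c d =
    subst (λ t → ℚ.∣ t ∣ ℚ.≤ ℚ.∣ a ℚ.- c ∣ ℚ.+ ℚ.∣ b ℚ.- d ∣)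
          (+-interchange-- a b c d)
          (ℚ.∣p+q∣≤∣p∣+∣q∣ (a ℚ.- c) (b ℚ.- d))

  +-cauchy : ∀ x y → IsCauchy (λ n → seq x n ℚ.+ seq y n)
  +-cauchy x y ε ε>0
    with cauchy x (½ ℚ.* ε) (½ε>0 ε>0) | cauchy y (½ ℚ.* ε) (½ε>0 ε>0)
  ... | M , f | N , g = M ℕ.⊔ N , λ m n p q → ℚ.≤-<-trans
    (∣+-difference∣≤ (seq x m) (seq y m) (seq x n) (seq y n))
    (subst (_ ℚ.<_) (½ε+½ε≡ε ε)
      (ℚ.+-mono-< (f m n (ℕ.m⊔n≤o⇒m≤o M N p) (ℕ.m⊔n≤o⇒m≤o M N q))
                  (g m n (ℕ.m⊔n≤o⇒n≤o M N p) (ℕ.m⊔n≤o⇒n≤o M N q))))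

  neg-cauchy : ∀ x → IsCauchy (λ n → ℚ.- seq x n)
  neg-cauchy x ε ε>0 with cauchy x ε ε>0
  ... | N , f = N , λ m n p q → subst (ℚ._< ε)
    (trans (∣p-q∣≡∣q-p∣ (seq x m) (seq x n))
      (cong ℚ.∣_∣ (q-p≡-p--q (seq x m) (seq x n))))
    (f m n p q)

  ∣∣-cauchy : ∀ x → IsCauchy (λ n → ℚ.∣ seq x n ∣)
  ∣∣-cauchy x ε ε>0 with cauchy x ε ε>0
  ... | N , f = N , λ m n p q →
    ℚ.≤-<-trans (∣∣p∣-∣q∣∣≤∣p-q∣ (seq x m) (seq x n)) (f m n p q)

  0<1 : 0ℚ ℚ.< 1ℚ
  0<1 = ℚ.positive⁻¹ 1ℚ

  EventuallyBoundedBy : ℝ → ℚ → Set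
  EventuallyBoundedBy x B = ∃[ N ] ∀ n → N ℕ.≤ n → ℚ.∣ seq x n ∣ ℚ.≤ B

  eventuallyBounded : ∀ x → ∃[ B ] 0ℚ ℚ.< B × EventuallyBoundedBy x B
  eventuallyBounded x with cauchy x 1ℚ 0<1
  ... | N , f = 1ℚ ℚ.+ ℚ.∣ seq x N ∣
    , ℚ.+-mono-<-≤ 0<1 (ℚ.0≤∣p∣ (seq x N))
    , N , λ n N≤n → ℚ.≤-trans (∣p∣≤∣p-q∣+∣q∣ (seq x n) (seq x N))
        (ℚ.+-monoˡ-≤ ℚ.∣ seq x N ∣ (ℚ.<⇒≤ (f n N N≤n ℕ.≤-refl)))

  ∣p*q∣≤ : ∀ p q {B δ} → ℚ.∣ p ∣ ℚ.≤ B → ℚ.∣ q ∣ ℚ.≤ δ → 0ℚ ℚ.≤ B →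
    ℚ.∣ p ℚ.* q ∣ ℚ.≤ B ℚ.* δ
  ∣p*q∣≤ p q {B} {δ} ∣p∣≤B ∣q∣≤δ B≥0 = subst (ℚ._≤ B ℚ.* δ) (sym (ℚ.∣p*q∣≡∣p∣*∣q∣ p q))
    (ℚ.≤-trans
      (ℚ.*-monoʳ-≤-nonNeg ℚ.∣ q ∣ {{ℚ.∣-∣-nonNeg q}} ∣p∣≤B)
      (ℚ.*-monoˡ-≤-nonNeg B {{ℚ.nonNegative B≥0}} ∣q∣≤δ))

  shrink : ∀ B → 0ℚ ℚ.< B → ∀ ε → 0ℚ ℚ.< ε →
    ∃[ δ ] 0ℚ ℚ.< δ × B ℚ.* δ ≡ ε
  shrink B B>0 ε ε>0 = 1/B ℚ.* ε , ℚ.positive⁻¹ _ {{1/B*ε>0}} ,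
    trans (sym (ℚ.*-assoc B 1/B ε))
      (trans (cong (ℚ._* ε) (ℚ.*-inverseʳ B {{B≢0}})) (ℚ.*-identityˡ ε))
    where
    B≢0 : ℚ.NonZero B
    B≢0 = ℚ.>-nonZero B>0
    1/B : ℚ
    1/B = (ℚ.1/ B) {{B≢0}}
    1/B*ε>0 : ℚ.Positive (1/B ℚ.* ε)
    1/B*ε>0 = ℚ.pos*pos⇒pos 1/B {{ℚ.1/pos⇒pos B {{ℚ.positive B>0}}}} ε {{ℚ.positive ε>0}}

  ∣*-difference∣≤ : ∀ a b c d {B C δ} → 0ℚ ℚ.≤ B → 0ℚ ℚ.≤ C →
    ℚ.∣ a ∣ ℚ.≤ B → ℚ.∣ b ℚ.- d ∣ ℚ.≤ δ → ℚ.∣ d ∣ ℚ.≤ C → ℚ.∣ a ℚ.- c ∣ ℚ.≤ δ →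
    ℚ.∣ a ℚ.* b ℚ.- c ℚ.* d ∣ ℚ.≤ (B ℚ.+ C) ℚ.* δ
  ∣*-difference∣≤ a b c d {B} {C} {δ} B≥0 C≥0 a≤B b-d≤δ d≤C a-c≤δ = subst₂ ℚ._≤_
    (cong ℚ.∣_∣ (*-difference a b c d)) (sym (ℚ.*-distribʳ-+ δ B C))
    (ℚ.≤-trans (ℚ.∣p+q∣≤∣p∣+∣q∣ (a ℚ.* (b ℚ.- d)) (d ℚ.* (a ℚ.- c)))
      (ℚ.+-mono-≤ (∣p*q∣≤ a (b ℚ.- d) a≤B b-d≤δ B≥0)
                  (∣p*q∣≤ d (a ℚ.- c) d≤C a-c≤δ C≥0)))

  ½ε<ε : ∀ {ε} → 0ℚ ℚ.< ε → ½ ℚ.* ε ℚ.< ε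
  ½ε<ε {ε} ε>0 = subst₂ ℚ._<_ (ℚ.+-identityʳ (½ ℚ.* ε)) (½ε+½ε≡ε ε)
    (ℚ.+-monoʳ-< (½ ℚ.* ε) (½ε>0 ε>0))

  *-cauchy-bounded : ∀ x y {B C δ ε} → 0ℚ ℚ.≤ B → 0ℚ ℚ.≤ C →
    EventuallyBoundedBy x B → EventuallyBoundedBy y C →
    0ℚ ℚ.< δ → (B ℚ.+ C) ℚ.* δ ℚ.< ε →
    ∃[ N ] ∀ m n → N ℕ.≤ m → N ℕ.≤ n →
      ℚ.∣ seq x m ℚ.* seq y m ℚ.- seq x n ℚ.* seq y n ∣ ℚ.< ε
  *-cauchy-bounded x y {δ = δ} B≥0 C≥0 (K , bx) (L , by) δ>0 [B+C]δ<ε =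
    let
      (M , f) = cauchy x δ δ>0
      (N , g) = cauchy y δ δ>0
    in (K ℕ.⊔ L) ℕ.⊔ (M ℕ.⊔ N) , λ m n p q →
    let
      pKL = ℕ.m⊔n≤o⇒m≤o (K ℕ.⊔ L) (M ℕ.⊔ N) p
      pMN = ℕ.m⊔n≤o⇒n≤o (K ℕ.⊔ L) (M ℕ.⊔ N) p
      qKL = ℕ.m⊔n≤o⇒m≤o (K ℕ.⊔ L) (M ℕ.⊔ N) q
      qMN = ℕ.m⊔n≤o⇒n≤o (K ℕ.⊔ L) (M ℕ.⊔ N) q
    in ℚ.≤-<-trans
      (∣*-difference∣≤ (seq x m) (seq y m) (seq x n) (seq y n) B≥0 C≥0
        (bx m (ℕ.m⊔n≤o⇒m≤o K L pKL))
        (ℚ.<⇒≤ (g m n (ℕ.m⊔n≤o⇒n≤o M N pMN) (ℕ.m⊔n≤o⇒n≤o M N qMN)))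
        (by n (ℕ.m⊔n≤o⇒n≤o K L qKL))
        (ℚ.<⇒≤ (f m n (ℕ.m⊔n≤o⇒m≤o M N pMN) (ℕ.m⊔n≤o⇒m≤o M N qMN))))
      [B+C]δ<ε

  *-cauchy : ∀ x y → IsCauchy (λ n → seq x n ℚ.* seq y n)
  *-cauchy x y ε ε>0 =
    let
      (B , B>0 , bx) = eventuallyBounded x
      (C , C>0 , by) = eventuallyBounded y
      (δ , δ>0 , [B+C]δ≡½ε) =
        shrink (B ℚ.+ C) (ℚ.+-mono-< B>0 C>0) (½ ℚ.* ε) (½ε>0 ε>0)
    in *-cauchy-bounded x y (ℚ.<⇒≤ B>0) (ℚ.<⇒≤ C>0) bx by δ>0
         (subst (ℚ._< ε) (sym [B+C]δ≡½ε) (½ε<ε ε>0))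

infix  8 -_
infixr 8 _^_
infixl 7 _*_
infixl 6 _+_ _-_

_+_ : ℝ → ℝ → ℝ
x + y = mkℝ (λ n → seq x n ℚ.+ seq y n) (+-cauchy x y)

-_ : ℝ → ℝ
- x = mkℝ (λ n → ℚ.- seq x n) (neg-cauchy x)

_-_ : ℝ → ℝ → ℝ
x - y = x + (- y)

_*_ : ℝ → ℝ → ℝ
x * y = mkℝ (λ n → seq x n ℚ.* seq y n) (*-cauchy x y)

∣_∣ : ℝ → ℝ
∣ x ∣ = mkℝ (λ n → ℚ.∣ seq x n ∣) (∣∣-cauchy x)

_^_ : ℝ → ℕ → ℝ
x ^ zero  = 1ℝ
x ^ suc n = x * x ^ n

-- A list a₀ ∷ a₁ ∷ … ∷ a_d ∷ [] stands for the polynomial a₀ + a₁X + … + a_dX^d;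
-- it is the zero polynomial exactly when all its entries vanish.
evalPoly : List ℤ → ℝ → ℝ
evalPoly []       x = 0ℝ
evalPoly (a ∷ as) x = fromℚ (a ℚ./ 1) + x * evalPoly as x

Algebraic : ℝ → Set
Algebraic x = ∃[ as ] Any (_≢ 0ℤ) as × evalPoly as x ≈ 0ℝ

Transcendental : ℝ → Set
Transcendental x = ¬ Algebraic x

-- No finite list exhausts the solutions.
InfinitelyMany : {A : Set} → (A → Set) → Set
InfinitelyMany {A} P = (as : List A) → ∃[ a ] a ∉ as × P a

record LiouvilleApproximation (ξ : ℝ) (N : ℕ) (pq : ℤ × ℕ) : Set where
  p : ℤ
  p = proj₁ pq

  q : ℕ
  q = proj₂ pq

  field
    q≥2 : 2 ℕ.≤ q

  instance
    q≢0 : ℕ.NonZero q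
    q≢0 = ℕ.>-nonZero (ℕ.<-trans ℕ.0<1+n q≥2)

    q^N≢0 : ℕ.NonZero (q ℕ.^ N)
    q^N≢0 = ℕ.m^n≢0 q N

  field
    nonzero : 0ℝ < ∣ ξ - fromℚ (p ℚ./ q) ∣
    close   : ∣ ξ - fromℚ (p ℚ./ q) ∣ < fromℚ (ℤ.+ 1 ℚ./ (q ℕ.^ N))

Liouville : ℝ → Set
Liouville ξ = ∀ N → 1 ℕ.≤ N → InfinitelyMany (LiouvilleApproximation ξ N)

-- Two elements of the subset are identified when they are equal as reals.
subsetSetoid : (ℝ → Set) → Setoid 0ℓ 0ℓ
subsetSetoid P = On.setoid {B = Σ ℝ P} ℝ-setoid proj₁

ContinuumMany : (ℝ → Set) → Set
ContinuumMany P = Bijection ℝ-setoid (subsetSetoid P)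

{-# OPTIONS --safe #-}

-- Let t (1 + k) = t k ^ (1 + k) * l k with a prime l k > t k, and let σ = Σ c k / t (1 + k) with
-- digits c k ∈ {1, 2}; the partial sum s k / t k is within 3 / t (1 + k) of σ.
-- If p / q is very close to ξ, then s k p^m / (t k q^m) is very close to σ ξ^m as soon as t k is at
-- most a fixed power of q while t (1 + k) exceeds a larger fixed power. As t (2 + k) is a huge power
-- of t (1 + k), a suitable k exists for every large q.
-- These fractions differ from σ ξ^m, because σ ξ^m is irrational: a rational value P / Q would have
-- to equal some of them with k large, but for m ≥ 2 this is impossible, since l k divides t (1 + k)
-- exactly once and divides none of s (1 + k), P, Q. For the same reason a nonzero integer polynomial
-- cannot vanish at s k / t k for large k, which makes σ transcendental.
-- Distinct digit sequences give distinct σ, and Dedekind cuts code real numbers by digit sequences;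
-- Cantor–Bernstein turns the resulting injection into a bijection.
module Submission where

-- For m = 1 the claim is false: σ is itself a Liouville number, hence so is ξ = 1 / σ, and σ ξ = 1.
-- Size estimates alone therefore cannot show that σ ξ^m is irrational; the primes l k are built
-- into the denominators to supply an arithmetic obstruction that sees the exponent m.
--
-- The digits are 1 and 2 rather than 0 and 1 because s (1 + k) is congruent to c k modulo l k, and
-- this residue must not vanish.
--
-- A rational value P / Q is compared with a fraction of denominator T = t k q^m. For T at least Q,
-- different fractions are at least 1 / (Q T), hence at least 1 / T^2, apart, while the error is
-- below 1 / T^2. So N = 2 forces equality with P / Q, and the primes refute the equality.
--
-- Excluded middle enters in three places: it turns irrationality into the positive gap demanded by
-- `_<_`, it decides the cuts, and it decides the chains in the Cantor-Bernstein argument.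
--
-- Closeness is mostly stated without division, as `∣ x - y ∣ * ⟦ W ⟧ ≤ 1ℚ`, and a fraction is a
-- rational with a known integer multiple, so nothing has to be in lowest terms.

-- Prime valuations, the denominators t and the numerators s

module Arithmetic where

  open import Data.List.Base using (_∷_; [])
  open import Data.List.Relation.Unary.All using (_∷_)
  open import Data.Nat.Base
  open import Data.Nat.Divisibility
  open import Data.Nat.ListAction using (product)
  open import Data.Nat.Primality
  open import Data.Nat.Tactic.RingSolver using (solve-∀)
  open import Data.Nat.Primality.Factorisation using (factorise)
  open import Data.Nat.Properties
  open import Data.Nat.Induction using (<-rec)
  open import Data.Product.Base using (∃-syntax; _×_; _,_; proj₁; proj₂)
  open import Data.Sum.Base using (_⊎_; inj₁; inj₂; [_,_]′)
  open import Function.Base using (_∘_; id)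
  open import Relation.Binary.PropositionalEquality
  open import Relation.Nullary using (yes; no; contradiction)

  prime∣^⇒prime∣ : ∀ {l} → Prime l → ∀ x m → l ∣ x ^ m → l ∣ x
  prime∣^⇒prime∣ {l} l-prime x zero    l∣1 =
    contradiction (∣1⇒≡1 l∣1) (nonTrivial⇒≢1 {{prime⇒nonTrivial l-prime}})
  prime∣^⇒prime∣ l-prime x (suc m) l∣x^[1+m] =
    [ id , prime∣^⇒prime∣ l-prime x m ]′ (euclidsLemma x (x ^ m) l-prime l∣x^[1+m])

  ∃primeDivisor : ∀ n → 2 ≤ n → ∃[ l ] Prime l × l ∣ n
  ∃primeDivisor n@(suc _) 2≤n with factorise n
  ... | record { factors = [] ; isFactorisation = n≡1 } = contradiction (sym n≡1) (<⇒≢ 2≤n)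
  ... | record { factors = l ∷ ls ; isFactorisation = n≡l*ls ; factorsPrime = l-prime ∷ _ } =
    l , l-prime , subst (l ∣_) (sym n≡l*ls) (m∣m*n (product ls))

  ∃prime> : ∀ n → ∃[ l ] Prime l × n < l
  ∃prime> n with ∃primeDivisor (suc (n !)) (s≤s (n!≥1 n))
    where
    n!≥1 : ∀ n → 1 ≤ n !
    n!≥1 n = >-nonZero⁻¹ (n !) {{n !≢0}}
  ... | l , l-prime , l∣1+n! = l , l-prime , ≰⇒> λ l≤n →
    contradiction (∣1⇒≡1 (∣m+n∣m⇒∣n (subst (l ∣_) (+-comm 1 (n !)) l∣1+n!) (l∣n! l≤n)))
      (nonTrivial⇒≢1 {{prime⇒nonTrivial l-prime}})
    where
    l∣l! : ∀ l → .{{NonZero l}} → l ∣ l !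
    l∣l! (suc l) = m∣m*n (l !)
    l∣n! : l ≤ n → l ∣ n !
    l∣n! l≤n = ∣-trans (l∣l! l {{prime⇒nonZero l-prime}}) (m≤n⇒m!∣n! l≤n)

  abstract
    -- Not necessarily the least prime above n: it is a prime factor of n! + 1. Only its primality
    -- and its size matter.
    nextPrime : ℕ → ℕ
    nextPrime n = proj₁ (∃prime> n)

    nextPrime-prime : ∀ n → Prime (nextPrime n)
    nextPrime-prime n = proj₁ (proj₂ (∃prime> n))

    n<nextPrime[n] : ∀ n → n < nextPrime n
    n<nextPrime[n] n = proj₂ (proj₂ (∃prime> n))

  ^-distribʳ-* : ∀ x y n → (x * y) ^ n ≡ x ^ n * y ^ n
  ^-distribʳ-* x y zero    = refl
  ^-distribʳ-* x y (suc n) = trans (cong (x * y *_) (^-distribʳ-* x y n))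
    ([m*n]*[o*p]≡[m*o]*[n*p] x y (x ^ n) (y ^ n))

  -- In a rational solution of a t l = b (p/q)^m the exponent of l would be 1 on the left
  -- and a multiple of m on the right.
  module _ {l} (l-prime : Prime l) {a b t} (l∤a : l ∤ a) (l∤b : l ∤ b) (l∤t : l ∤ t) where

    private
      instance
        l≢0 : NonZero l
        l≢0 = prime⇒nonZero l-prime

      regroup₁ : ∀ a t l q → l * (a * t * q) ≡ a * (t * l) * q
      regroup₁ = solve-∀

      regroup₂ : ∀ b l k x → b * (x * (l * (l * k))) ≡ l * (b * x * (l * k))
      regroup₂ = solve-∀

      regroup₃ : ∀ a t l k x → l * k * (a * (t * l) * x) ≡ a * t * (x * (l * (l * k)))
      regroup₃ = solve-∀

    noPowerRatio : ∀ n p q → a * (t * l) * q ^ (2 + n) ≡ b * p ^ (2 + n) → p ≡ 0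
    noPowerRatio n = <-rec _ step
      where
      open ≡-Reasoning
      step : ∀ p →
        (∀ {p'} → p' < p → ∀ q → a * (t * l) * q ^ (2 + n) ≡ b * p' ^ (2 + n) → p' ≡ 0) →
        ∀ q → a * (t * l) * q ^ (2 + n) ≡ b * p ^ (2 + n) → p ≡ 0
      step zero      _   q eq = refl
      step p@(suc _) rec q eq = contradiction (rec p'<p q' eq') (≢-nonZero⁻¹ p' {{p'≢0}})
        where
        l∣p : l ∣ p
        l∣p = [ (λ l∣b → contradiction l∣b l∤b) , prime∣^⇒prime∣ l-prime p (2 + n) ]′
          (euclidsLemma b (p ^ (2 + n)) l-prime
            (subst (l ∣_) eq (∣m⇒∣m*n (q ^ (2 + n)) (∣n⇒∣m*n a (n∣m*n t)))))
        p' : ℕ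
        p' = quotient l∣p
        p≡p'l : p ≡ p' * l
        p≡p'l = _∣_.equality l∣p
        p'≢0 : NonZero p'
        p'≢0 = ≢-nonZero λ p'≡0 → contradiction (trans p≡p'l (cong (_* l) p'≡0)) λ ()
        p'<p : p' < p
        p'<p = subst (p' <_) (sym p≡p'l)
          (m<m*n p' l {{p'≢0}} (nonTrivial⇒n>1 l {{prime⇒nonTrivial l-prime}}))
        -- The left side has only one visible factor l. As the exponent is at least 2, cancelling it
        -- leaves a factor l on the right, which only q can supply. Dividing p and q by l then gives
        -- a smaller solution.
        reduced : a * t * q ^ (2 + n) ≡ b * p' ^ (2 + n) * (l * l ^ n)
        reduced = *-cancelˡ-≡ _ _ l (begin
          l * (a * t * q ^ (2 + n))                ≡⟨ regroup₁ a t l (q ^ (2 + n)) ⟩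
          a * (t * l) * q ^ (2 + n)                ≡⟨ eq ⟩
          b * p ^ (2 + n)                          ≡⟨ cong (λ z → b * z ^ (2 + n)) p≡p'l ⟩
          b * (p' * l) ^ (2 + n)                   ≡⟨ cong (b *_) (^-distribʳ-* p' l (2 + n)) ⟩
          b * (p' ^ (2 + n) * l ^ (2 + n))         ≡⟨ regroup₂ b l (l ^ n) (p' ^ (2 + n)) ⟩
          l * (b * p' ^ (2 + n) * (l * l ^ n))     ∎)
        l∣q : l ∣ q
        l∣q = [ (λ l∣at → contradiction (euclidsLemma a t l-prime l∣at) [ l∤a , l∤t ]′)
              , prime∣^⇒prime∣ l-prime q (2 + n) ]′
          (euclidsLemma (a * t) (q ^ (2 + n)) l-prime
            (subst (l ∣_) (sym reduced) (∣n⇒∣m*n (b * p' ^ (2 + n)) (m∣m*n (l ^ n)))))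
        q' : ℕ
        q' = quotient l∣q
        eq' : a * (t * l) * q' ^ (2 + n) ≡ b * p' ^ (2 + n)
        eq' = *-cancelˡ-≡ _ _ (l ^ (1 + n)) {{m^n≢0 l (1 + n)}} (begin
          l ^ (1 + n) * (a * (t * l) * q' ^ (2 + n)) ≡⟨ regroup₃ a t l (l ^ n) (q' ^ (2 + n)) ⟩
          a * t * (q' ^ (2 + n) * l ^ (2 + n))       ≡⟨ cong (a * t *_) (^-distribʳ-* q' l (2 + n)) ⟨
          a * t * (q' * l) ^ (2 + n)
            ≡⟨ cong (λ z → a * t * z ^ (2 + n)) (_∣_.equality l∣q) ⟨
          a * t * q ^ (2 + n)                        ≡⟨ reduced ⟩
          b * p' ^ (2 + n) * (l * l ^ n)             ≡⟨ *-comm (b * p' ^ (2 + n)) (l * l ^ n) ⟩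
          l ^ (1 + n) * (b * p' ^ (2 + n))           ∎)

  abstract
    -- The start value 8 makes the reciprocals shrink at least eightfold at each step. This covers
    -- the factor 3 in the tail bound and the factor 4 that separates different digits, and it puts
    -- every `l k` above the digits.
    t : ℕ → ℕ
    t zero    = 8
    t (suc k) = t k ^ suc k * nextPrime (t k)

    t-zero : t 0 ≡ 8
    t-zero = refl

    t-suc : ∀ k → t (suc k) ≡ t k ^ suc k * nextPrime (t k)
    t-suc k = refl

  instance
    t≢0 : ∀ {k} → NonZero (t k)
    t≢0 {zero}  = subst NonZero (sym t-zero) _
    t≢0 {suc k} = subst NonZero (sym (t-suc k))
      (m*n≢0 (t k ^ suc k) (nextPrime (t k))
        {{m^n≢0 (t k) (suc k)}} {{prime⇒nonZero (nextPrime-prime (t k))}})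

  t^[2+k]<t[1+k] : ∀ k → t k ^ (2 + k) < t (suc k)
  t^[2+k]<t[1+k] k = begin-strict
    t k ^ (2 + k)                 ≡⟨ *-comm (t k) (t k ^ suc k) ⟩
    t k ^ suc k * t k
      <⟨ *-monoʳ-< (t k ^ suc k) {{m^n≢0 (t k) (suc k)}} (n<nextPrime[n] (t k)) ⟩
    t k ^ suc k * nextPrime (t k) ≡⟨ t-suc k ⟨
    t (suc k)                     ∎
    where open ≤-Reasoning

  t²<t[1+k] : ∀ k → t k * t k < t (suc k)
  t²<t[1+k] k = ≤-<-trans
    (*-monoʳ-≤ (t k) (m≤m*n (t k) (t k ^ k) {{m^n≢0 (t k) k}})) (t^[2+k]<t[1+k] k)

  t<t[1+k] : ∀ k → t k < t (suc k)
  t<t[1+k] k = ≤-<-trans (m≤m*n (t k) (t k)) (t²<t[1+k] k)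

  t≥8 : ∀ k → 8 ≤ t k
  t≥8 zero    = ≤-reflexive (sym t-zero)
  t≥8 (suc k) = ≤-trans (t≥8 k) (<⇒≤ (t<t[1+k] k))

  8t≤t[1+k] : ∀ k → 8 * t k ≤ t (suc k)
  8t≤t[1+k] k = ≤-trans (*-monoˡ-≤ (t k) (t≥8 k)) (<⇒≤ (t²<t[1+k] k))

  k<t : ∀ k → k < t k
  k<t zero    = ≤-trans (s≤s z≤n) (t≥8 0)
  k<t (suc k) = ≤-<-trans (k<t k) (t<t[1+k] k)

  t-mono-≤ : ∀ {j k} → j ≤ k → t j ≤ t k
  t-mono-≤ {j} = mono ∘ ≤⇒≤′
    where
    mono : ∀ {k} → j ≤′ k → t j ≤ t k
    mono ≤′-refl             = ≤-refl
    mono (≤′-step {k} j≤′k) = ≤-trans (mono j≤′k) (<⇒≤ (t<t[1+k] k))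

  ∃t≤q<t : ∀ K q → t K ≤ q → ∃[ k ] K ≤ k × t k ≤ q × q < t (suc k)
  ∃t≤q<t K q tK≤q = search q (k<t q)
    where
    search : ∀ n → q < t n → ∃[ k ] K ≤ k × t k ≤ q × q < t (suc k)
    search zero    q<t0 = contradiction (≤-trans (t-mono-≤ {0} {K} z≤n) tK≤q) (<⇒≱ q<t0)
    search (suc n) q<t with q <? t n
    ... | yes q<tn = search n q<tn
    ... | no  q≮tn = n , K≤n , ≮⇒≥ q≮tn , q<t
      where
      K≤n : K ≤ n
      K≤n = ≮⇒≥ λ n<K → contradiction (≤-trans (t-mono-≤ n<K) tK≤q) (<⇒≱ q<t)

  -- If t (1 + k) is at most a fixed power of q, then t (2 + k) exceeds q^(2 + k), and
  -- hence any fixed power of q once k is large.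
  separatedScale : ∀ m N K → ∃[ M ] ∃[ Q ] ∀ q → Q ≤ q →
    ∃[ k ] K ≤ k × (t k * q ^ m) ^ N ≤ q ^ M × q * (t k * q ^ m) ^ N < t (suc k)
  separatedScale m N K = M , t K' , scale
    where
    -- If t k ≤ q, then q (t k q^m)^N ≤ q^X, so k works as soon as q^X < t (1 + k). Otherwise t (1 +
    -- k) ≤ q^X gives (t (1 + k) q^m)^N ≤ q^M, and 1 + k works: since M ≤ k and q < t (1 + k), the
    -- power q^(1 + M) stays below t (2 + k).
    X M K' : ℕ
    X  = suc ((1 + m) * N)
    M  = (X + m) * N
    K' = K ⊔ M
    scale : ∀ q → t K' ≤ q →
      ∃[ k ] K ≤ k × (t k * q ^ m) ^ N ≤ q ^ M × q * (t k * q ^ m) ^ N < t (suc k)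
    scale q tK'≤q with ∃t≤q<t K' q tK'≤q
    ... | k , K'≤k , tk≤q , q<t[1+k] with q ^ X <? t (suc k)
    ... | yes q^X<t[1+k] = k , ≤-trans (m≤m⊔n K M) K'≤k
      , ≤-trans bound (^-monoʳ-≤ q {{q≢0}} (*-monoˡ-≤ N (+-monoˡ-≤ m {1} {X} (s≤s z≤n))))
      , ≤-<-trans (*-monoʳ-≤ q bound) q^X<t[1+k]
      where
      q≢0 : NonZero q
      q≢0 = >-nonZero (≤-trans (≤-trans (s≤s z≤n) (t≥8 k)) tk≤q)
      bound : (t k * q ^ m) ^ N ≤ q ^ ((1 + m) * N)
      bound = ≤-trans (^-monoˡ-≤ N (*-monoˡ-≤ (q ^ m) tk≤q))
        (≤-reflexive (^-*-assoc q (1 + m) N))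
    ... | no  q^X≮t[1+k] = suc k , ≤-trans (≤-trans (m≤m⊔n K M) K'≤k) (n≤1+n k)
      , bound , (begin-strict
        q * (t (suc k) * q ^ m) ^ N ≤⟨ *-monoʳ-≤ q bound ⟩
        q ^ suc M
          ≤⟨ ^-monoʳ-≤ q {{q≢0}} (s≤s (≤-trans (m≤n⊔m K M) (≤-trans K'≤k (m≤n+m k 2)))) ⟩
        q ^ (3 + k)                 ≤⟨ ^-monoˡ-≤ (3 + k) (<⇒≤ q<t[1+k]) ⟩
        t (suc k) ^ (3 + k)         <⟨ t^[2+k]<t[1+k] (suc k) ⟩
        t (2 + k)                   ∎)
      where
      open ≤-Reasoning
      q≢0 : NonZero q
      q≢0 = >-nonZero (≤-trans (≤-trans (s≤s z≤n) (t≥8 k)) tk≤q)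
      bound : (t (suc k) * q ^ m) ^ N ≤ q ^ M
      bound = begin
        (t (suc k) * q ^ m) ^ N ≤⟨ ^-monoˡ-≤ N (*-monoˡ-≤ (q ^ m) (≮⇒≥ q^X≮t[1+k])) ⟩
        (q ^ X * q ^ m) ^ N     ≡⟨ cong (_^ N) (^-distribˡ-+-* q X m) ⟨
        (q ^ (X + m)) ^ N       ≡⟨ ^-*-assoc q (X + m) N ⟩
        q ^ M                   ∎

  -- s c k / t k is the k-th partial sum of the series Σ c k / t (1 + k).
  s : (ℕ → ℕ) → ℕ → ℕ
  s c zero    = 0
  s c (suc k) = s c k * (t k ^ k * nextPrime (t k)) + c k

  IsDigit : ℕ → Set
  IsDigit d = d ≡ 1 ⊎ d ≡ 2

  digit<3 : ∀ {d} → IsDigit d → d < 3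
  digit<3 (inj₁ refl) = s≤s (s≤s z≤n)
  digit<3 (inj₂ refl) = ≤-refl

  digit>0 : ∀ {d} → IsDigit d → 0 < d
  digit>0 (inj₁ refl) = z<s
  digit>0 (inj₂ refl) = z<s

  l : ℕ → ℕ
  l k = nextPrime (t k)

  l-prime : ∀ k → Prime (l k)
  l-prime k = nextPrime-prime (t k)

  l>8 : ∀ k → 8 < l k
  l>8 k = ≤-<-trans (t≥8 k) (n<nextPrime[n] (t k))

  k<l : ∀ k → k < l k
  k<l k = <-trans (k<t k) (n<nextPrime[n] (t k))

  l∣t : ∀ k → l k ∣ t (suc k)
  l∣t k = subst (l k ∣_) (sym (t-suc k)) (n∣m*n (t k ^ suc k))

  l∤small : ∀ k {n} → .{{NonZero n}} → n < l k → l k ∤ n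
  l∤small k n<l l∣n = contradiction n<l (≤⇒≯ (∣⇒≤ l∣n))

  -- Modulo `l k` the numerator reduces to its last digit `c k`, which lies strictly between 0 and
  -- `l k`.
  l∤s : ∀ {c} → (∀ k → IsDigit (c k)) → ∀ k → l k ∤ s c (suc k)
  l∤s {c} c-digits k l∣s = l∤small k {{>-nonZero (digit>0 (c-digits k))}}
    (<-trans (digit<3 (c-digits k)) (≤-<-trans (s≤s (s≤s (s≤s z≤n))) (l>8 k)))
    (∣m+n∣m⇒∣n l∣s (∣n⇒∣m*n (s c k) (n∣m*n (t k ^ k))))

  l∤t^ : ∀ k → l k ∤ t k ^ suc k
  l∤t^ k l∣t^ = l∤small k (n<nextPrime[n] (t k)) (prime∣^⇒prime∣ (l-prime k) (t k) (suc k) l∣t^)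

  -- This is a / b = (s / t) (p / q)^m with denominators cleared. As l k > k bounds a and b, for a ≠
  -- 0 the prime `l k` occurs exactly once outside the powers of p and q, which `noPowerRatio`
  -- excludes.
  s/t-notPowerRatio : ∀ {c} → (∀ k → IsDigit (c k)) → ∀ {a b} k n p q →
    a ≤ k → .{{NonZero b}} → b ≤ k → p ≢ 0 →
    a * t (suc k) * q ^ (2 + n) ≢ b * s c (suc k) * p ^ (2 + n)
  s/t-notPowerRatio {c} c-digits {a} {b} k n p q a≤k b≤k p≢0 eq = notRatio a a≤k eq
    where
    l∤bs : l k ∤ b * s c (suc k)
    l∤bs l∣bs = [ l∤small k (≤-<-trans b≤k (k<l k)) , l∤s c-digits k ]′
      (euclidsLemma b (s c (suc k)) (l-prime k) l∣bs)
    notRatio : ∀ a → a ≤ k → a * t (suc k) * q ^ (2 + n) ≢ b * s c (suc k) * p ^ (2 + n)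
    -- Zero is the only a up to k that `l k` divides, so it needs its own argument: the right side
    -- would have to vanish.
    notRatio zero      _   eq with m*n≡0⇒m≡0∨n≡0 (b * s c (suc k)) (sym eq)
    ... | inj₁ bs≡0  = l∤bs (subst (l k ∣_) (sym bs≡0) (l k ∣0))
    ... | inj₂ p^m≡0 = p≢0 (m^n≡0⇒m≡0 p (2 + n) p^m≡0)
    notRatio a@(suc _) a≤k eq = p≢0
      (noPowerRatio (l-prime k) (l∤small k (≤-<-trans a≤k (k<l k))) l∤bs (l∤t^ k) n p q
        (subst (λ t' → a * t' * q ^ (2 + n) ≡ b * s c (suc k) * p ^ (2 + n)) (t-suc k) eq))

-- Embedding of the integers in the rationals, and estimates with denominators cleared

module Rationals where

  open import Data.Integer.Base as ℤ using (ℤ; +_)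
  import Data.Integer.Properties as ℤ
  open import Data.Nat.Base as ℕ using (ℕ; zero; suc)
  import Data.Nat.Properties as ℕ
  open import Data.Product.Base using (∃-syntax; _,_)
  open import Data.Rational.Base
  open import Data.Rational.Properties
  import Data.Rational.Unnormalised.Base as ℚᵘ
  import Data.Rational.Unnormalised.Properties as ℚᵘ
  open import Data.Sum.Base using (inj₁; inj₂)
  open import Function.Base using (_∘_)
  open import Level using (0ℓ)
  open import Relation.Binary.PropositionalEquality
  open import Relation.Nullary.Decidable.Core using (dec⇒maybe)
  open import Tactic.RingSolver using (solve-∀)
  open import Tactic.RingSolver.Core.AlmostCommutativeRing
    using (AlmostCommutativeRing; fromCommutativeRing)

  ℚ-ring : AlmostCommutativeRing 0ℓ 0ℓ
  ℚ-ring = fromCommutativeRing +-*-commutativeRing (λ q → dec⇒maybe (0ℚ ≟ q))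

  toℚᵘ-/ : ∀ i n .{{_ : ℕ.NonZero n}} → toℚᵘ (i / n) ℚᵘ.≃ i ℚᵘ./ n
  toℚᵘ-/ i (suc n) = toℚᵘ-fromℚᵘ (ℚᵘ.mkℚᵘ i n)

  -- Abstract, since otherwise unification normalises fractions.
  abstract
    ι : ℤ → ℚ
    ι i = i / 1

  ⟦_⟧ : ℕ → ℚ
  ⟦ n ⟧ = ι (+ n)

  abstract
    ι-def : ∀ i → ι i ≡ i / 1
    ι-def i = refl

    ⟦0⟧≡0 : ⟦ 0 ⟧ ≡ 0ℚ
    ⟦0⟧≡0 = refl

    ⟦1⟧≡1 : ⟦ 1 ⟧ ≡ 1ℚ
    ⟦1⟧≡1 = refl

    ι-+ : ∀ i j → ι (i ℤ.+ j) ≡ ι i + ι j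
    ι-+ i j = toℚᵘ-injective (begin
      toℚᵘ (ι (i ℤ.+ j))        ≈⟨ toℚᵘ-/ (i ℤ.+ j) 1 ⟩
      (i ℤ.+ j) ℚᵘ./ 1
        ≈⟨ ℚᵘ.*≡* (cong (ℤ._* (+ 1)) (sym (cong₂ ℤ._+_ (ℤ.*-identityʳ i) (ℤ.*-identityʳ j)))) ⟩
      i ℚᵘ./ 1 ℚᵘ.+ j ℚᵘ./ 1    ≈⟨ ℚᵘ.+-cong (toℚᵘ-/ i 1) (toℚᵘ-/ j 1) ⟨
      toℚᵘ (ι i) ℚᵘ.+ toℚᵘ (ι j) ≈⟨ toℚᵘ-homo-+ (ι i) (ι j) ⟨
      toℚᵘ (ι i + ι j)          ∎)
      where open ℚᵘ.≃-Reasoning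

    ι-* : ∀ i j → ι (i ℤ.* j) ≡ ι i * ι j
    ι-* i j = toℚᵘ-injective (begin
      toℚᵘ (ι (i ℤ.* j))        ≈⟨ toℚᵘ-/ (i ℤ.* j) 1 ⟩
      i ℚᵘ./ 1 ℚᵘ.* (j ℚᵘ./ 1)    ≈⟨ ℚᵘ.*-cong (toℚᵘ-/ i 1) (toℚᵘ-/ j 1) ⟨
      toℚᵘ (ι i) ℚᵘ.* toℚᵘ (ι j) ≈⟨ toℚᵘ-homo-* (ι i) (ι j) ⟨
      toℚᵘ (ι i * ι j)          ∎)
      where open ℚᵘ.≃-Reasoning

    ι-neg : ∀ i → ι (ℤ.- i) ≡ - ι i
    ι-neg (+ zero)    = refl
    ι-neg (+ suc n)   = refl
    ι-neg ℤ.-[1+ n ]  = sym (neg-involutive (ι (+ suc n)))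
      where
      neg-involutive : ∀ p → - (- p) ≡ p
      neg-involutive = solve-∀ ℚ-ring

    /-*-cancel : ∀ i n .{{_ : ℕ.NonZero n}} → i / n * ⟦ n ⟧ ≡ ι i
    /-*-cancel i n@(suc n-1) = toℚᵘ-injective (begin
      toℚᵘ (i / n * ⟦ n ⟧)            ≈⟨ toℚᵘ-homo-* (i / n) ⟦ n ⟧ ⟩
      toℚᵘ (i / n) ℚᵘ.* toℚᵘ ⟦ n ⟧     ≈⟨ ℚᵘ.*-cong (toℚᵘ-/ i n) (toℚᵘ-/ (+ n) 1) ⟩
      i ℚᵘ./ n ℚᵘ.* (+ n ℚᵘ./ 1)
        ≈⟨ ℚᵘ.*≡* (trans (ℤ.*-identityʳ (i ℤ.* + n)) (cong (λ m → i ℤ.* + m) (sym (ℕ.*-identityʳ n)))) ⟩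
      i ℚᵘ./ 1                        ≈⟨ toℚᵘ-/ i 1 ⟨
      toℚᵘ (ι i)                      ∎)
      where open ℚᵘ.≃-Reasoning

    ι-mono-≤ : ∀ {i j} → i ℤ.≤ j → ι i ≤ ι j
    ι-mono-≤ {i} {j} i≤j = toℚᵘ-cancel-≤ (ℚᵘ.≤-respʳ-≃ (ℚᵘ.≃-sym (toℚᵘ-/ j 1))
      (ℚᵘ.≤-respˡ-≃ (ℚᵘ.≃-sym (toℚᵘ-/ i 1)) (ℚᵘ.*≤* (ℤ.*-monoʳ-≤-nonNeg (+ 1) i≤j))))

    ι-mono-< : ∀ {i j} → i ℤ.< j → ι i < ι j
    ι-mono-< {i} {j} i<j = toℚᵘ-cancel-< (ℚᵘ.<-respʳ-≃ (ℚᵘ.≃-sym (toℚᵘ-/ j 1))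
      (ℚᵘ.<-respˡ-≃ (ℚᵘ.≃-sym (toℚᵘ-/ i 1)) (ℚᵘ.*<* (ℤ.*-monoʳ-<-pos (+ 1) i<j))))

  ⟦⟧-+ : ∀ m n → ⟦ m ℕ.+ n ⟧ ≡ ⟦ m ⟧ + ⟦ n ⟧
  ⟦⟧-+ m n = trans (cong ι (ℤ.pos-+ m n)) (ι-+ (+ m) (+ n))

  ⟦⟧-* : ∀ m n → ⟦ m ℕ.* n ⟧ ≡ ⟦ m ⟧ * ⟦ n ⟧
  ⟦⟧-* m n = trans (cong ι (ℤ.pos-* m n)) (ι-* (+ m) (+ n))

  ⟦⟧-mono-≤ : ∀ {m n} → m ℕ.≤ n → ⟦ m ⟧ ≤ ⟦ n ⟧
  ⟦⟧-mono-≤ = ι-mono-≤ ∘ ℤ.+≤+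

  ⟦⟧-mono-< : ∀ {m n} → m ℕ.< n → ⟦ m ⟧ < ⟦ n ⟧
  ⟦⟧-mono-< = ι-mono-< ∘ ℤ.+<+

  ⟦⟧-nonNeg : ∀ n → NonNegative ⟦ n ⟧
  ⟦⟧-nonNeg n = nonNegative (subst (_≤ ⟦ n ⟧) ⟦0⟧≡0 (⟦⟧-mono-≤ ℕ.z≤n))

  ⟦⟧-pos : ∀ n .{{_ : ℕ.NonZero n}} → Positive ⟦ n ⟧
  ⟦⟧-pos n = positive (subst (_< ⟦ n ⟧) ⟦0⟧≡0 (⟦⟧-mono-< (ℕ.>-nonZero⁻¹ n)))

  1+1≡⟦2⟧ : 1ℚ + 1ℚ ≡ ⟦ 2 ⟧
  1+1≡⟦2⟧ = sym (trans (⟦⟧-+ 1 1) (cong₂ _+_ ⟦1⟧≡1 ⟦1⟧≡1))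

  ∣ι∣ : ∀ i → ∣ ι i ∣ ≡ ⟦ ℤ.∣ i ∣ ⟧
  ∣ι∣ (+ n)      = 0≤p⇒∣p∣≡p (nonNegative⁻¹ ⟦ n ⟧ {{⟦⟧-nonNeg n}})
  ∣ι∣ ℤ.-[1+ n ] = trans (cong ∣_∣ (ι-neg (+ suc n))) (trans (∣-p∣≡∣p∣ ⟦ suc n ⟧) (∣ι∣ (+ suc n)))

  0≤⇒*-monoʳ-≤ : ∀ {p q} r → 0ℚ ≤ r → p ≤ q → p * r ≤ q * r
  0≤⇒*-monoʳ-≤ r 0≤r = *-monoʳ-≤-nonNeg r {{nonNegative 0≤r}}

  0≤⇒*-monoˡ-≤ : ∀ {p q} r → 0ℚ ≤ r → p ≤ q → r * p ≤ r * q
  0≤⇒*-monoˡ-≤ r 0≤r = *-monoˡ-≤-nonNeg r {{nonNegative 0≤r}}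

  *-mono-≤ : ∀ {p q r u} → 0ℚ ≤ p → 0ℚ ≤ u → p ≤ q → r ≤ u → p * r ≤ q * u
  *-mono-≤ {p} {u = u} 0≤p 0≤u p≤q r≤u = ≤-trans (0≤⇒*-monoˡ-≤ p 0≤p r≤u) (0≤⇒*-monoʳ-≤ u 0≤u p≤q)

  0≤* : ∀ {p q} → 0ℚ ≤ p → 0ℚ ≤ q → 0ℚ ≤ p * q
  0≤* {p} {q} 0≤p 0≤q = nonNegative⁻¹ _ {{nonNeg*nonNeg⇒nonNeg p {{nonNegative 0≤p}} q {{nonNegative 0≤q}}}}

  0≤⟦⟧ : ∀ n → 0ℚ ≤ ⟦ n ⟧
  0≤⟦⟧ n = nonNegative⁻¹ ⟦ n ⟧ {{⟦⟧-nonNeg n}}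

  scale-≤ : ∀ {m n p r} → 0ℚ ≤ p → m ℕ.≤ n → p * ⟦ n ⟧ ≤ r → p * ⟦ m ⟧ ≤ r
  scale-≤ {p = p} 0≤p m≤n = ≤-trans (0≤⇒*-monoˡ-≤ p 0≤p (⟦⟧-mono-≤ m≤n))

  p-0≡p : ∀ p → p - 0ℚ ≡ p
  p-0≡p = +-identityʳ

  +-cancelˡ-< : ∀ r {p q} → r + p < r + q → p < q
  +-cancelˡ-< r {p} {q} r+p<r+q = subst₂ _<_ (cancel r p) (cancel r q) (+-monoʳ-< (- r) r+p<r+q)
    where
    cancel : ∀ r p → - r + (r + p) ≡ p
    cancel = solve-∀ ℚ-ring

  ⟦⟧-cancel-≤ : ∀ {m n} → ⟦ m ⟧ ≤ ⟦ n ⟧ → m ℕ.≤ n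
  ⟦⟧-cancel-≤ m≤n = ℕ.≮⇒≥ λ n<m → <-irrefl refl (<-≤-trans (⟦⟧-mono-< n<m) m≤n)

  ∣p∣*⟦⟧ : ∀ p {i} n → p * ⟦ n ⟧ ≡ ι i → ∣ p ∣ * ⟦ n ⟧ ≡ ⟦ ℤ.∣ i ∣ ⟧
  ∣p∣*⟦⟧ p {i} n p*n≡i = begin
    ∣ p ∣ * ⟦ n ⟧     ≡⟨ cong (∣ p ∣ *_) (∣ι∣ (+ n)) ⟨
    ∣ p ∣ * ∣ ⟦ n ⟧ ∣ ≡⟨ ∣p*q∣≡∣p∣*∣q∣ p ⟦ n ⟧ ⟨
    ∣ p * ⟦ n ⟧ ∣     ≡⟨ cong ∣_∣ p*n≡i ⟩
    ∣ ι i ∣           ≡⟨ ∣ι∣ i ⟩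
    ⟦ ℤ.∣ i ∣ ⟧       ∎
    where open ≡-Reasoning

  ∣p-q∣≡∣q-p∣ : ∀ p q → ∣ p - q ∣ ≡ ∣ q - p ∣
  ∣p-q∣≡∣q-p∣ p q = trans (sym (∣-p∣≡∣p∣ (p - q))) (cong ∣_∣ (flip p q))
    where
    flip : ∀ p q → - (p - q) ≡ q - p
    flip = solve-∀ ℚ-ring

  ∣p-r∣≤∣p-q∣+∣q-r∣ : ∀ p q r → ∣ p - r ∣ ≤ ∣ p - q ∣ + ∣ q - r ∣
  ∣p-r∣≤∣p-q∣+∣q-r∣ p q r =
    subst (λ t → ∣ t ∣ ≤ ∣ p - q ∣ + ∣ q - r ∣) (telescope p q r) (∣p+q∣≤∣p∣+∣q∣ (p - q) (q - r))
    where
    telescope : ∀ p q r → (p - q) + (q - r) ≡ p - r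
    telescope = solve-∀ ℚ-ring

  ∣p∣≤∣p-q∣+∣q∣ : ∀ p q → ∣ p ∣ ≤ ∣ p - q ∣ + ∣ q ∣
  ∣p∣≤∣p-q∣+∣q∣ p q = subst (λ t → ∣ t ∣ ≤ ∣ p - q ∣ + ∣ q ∣) (cancel p q) (∣p+q∣≤∣p∣+∣q∣ (p - q) q)
    where
    cancel : ∀ p q → (p - q) + q ≡ p
    cancel = solve-∀ ℚ-ring

  ≤⟦⟧ : ∀ p → ∃[ n ] p ≤ ⟦ n ⟧
  ≤⟦⟧ p = ℤ.∣ ↥ p ∣ , *-cancelʳ-≤-pos ⟦ ↧ₙ p ⟧ {{⟦⟧-pos (↧ₙ p)}} (begin
    p * ⟦ ↧ₙ p ⟧                ≡⟨ cong (_* ⟦ ↧ₙ p ⟧) (↥p/↧p≡p p) ⟨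
    ↥ p / ↧ₙ p * ⟦ ↧ₙ p ⟧       ≡⟨ /-*-cancel (↥ p) (↧ₙ p) ⟩
    ι (↥ p)                     ≤⟨ ι-mono-≤ (i≤∣i∣ (↥ p)) ⟩
    ⟦ ℤ.∣ ↥ p ∣ ⟧               ≤⟨ ⟦⟧-mono-≤ (ℕ.m≤m*n ℤ.∣ ↥ p ∣ (↧ₙ p)) ⟩
    ⟦ ℤ.∣ ↥ p ∣ ℕ.* ↧ₙ p ⟧      ≡⟨ ⟦⟧-* ℤ.∣ ↥ p ∣ (↧ₙ p) ⟩
    ⟦ ℤ.∣ ↥ p ∣ ⟧ * ⟦ ↧ₙ p ⟧    ∎)
    where
    open ≤-Reasoning
    i≤∣i∣ : ∀ i → i ℤ.≤ + ℤ.∣ i ∣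
    i≤∣i∣ (+ n)      = ℤ.≤-refl
    i≤∣i∣ ℤ.-[1+ n ] = ℤ.-≤+

  archimedean : ∀ p → 0ℚ < p → ∃[ n ] 1ℚ < p * ⟦ n ⟧
  -- A positive rational times its denominator is an integer at least 1; the factor 2 makes the
  -- inequality strict.
  archimedean p 0<p = ↧ₙ p ℕ.* 2 , (begin-strict
    1ℚ                         ≡⟨ ⟦1⟧≡1 ⟨
    ⟦ 1 ⟧                      <⟨ ⟦⟧-mono-< {1} {2} (ℕ.s≤s (ℕ.s≤s ℕ.z≤n)) ⟩
    ⟦ 2 ⟧                      ≡⟨ *-identityˡ ⟦ 2 ⟧ ⟨
    1ℚ * ⟦ 2 ⟧                 ≡⟨ cong (_* ⟦ 2 ⟧) ⟦1⟧≡1 ⟨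
    ⟦ 1 ⟧ * ⟦ 2 ⟧              ≤⟨ 0≤⇒*-monoʳ-≤ ⟦ 2 ⟧ (0≤⟦⟧ 2) (ι-mono-≤ (1≤↥p p (positive 0<p))) ⟩
    ι (↥ p) * ⟦ 2 ⟧            ≡⟨ cong (_* ⟦ 2 ⟧) (/-*-cancel (↥ p) (↧ₙ p)) ⟨
    ↥ p / ↧ₙ p * ⟦ ↧ₙ p ⟧ * ⟦ 2 ⟧ ≡⟨ cong (λ r → r * ⟦ ↧ₙ p ⟧ * ⟦ 2 ⟧) (↥p/↧p≡p p) ⟩
    p * ⟦ ↧ₙ p ⟧ * ⟦ 2 ⟧       ≡⟨ *-assoc p ⟦ ↧ₙ p ⟧ ⟦ 2 ⟧ ⟩
    p * (⟦ ↧ₙ p ⟧ * ⟦ 2 ⟧)     ≡⟨ cong (p *_) (⟦⟧-* (↧ₙ p) 2) ⟨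
    p * ⟦ ↧ₙ p ℕ.* 2 ⟧         ∎)
    where
    open ≤-Reasoning
    1≤↥p : ∀ p → Positive p → + 1 ℤ.≤ ↥ p
    1≤↥p (mkℚ (+ suc n) _ _) _ = ℤ.+≤+ (ℕ.s≤s ℕ.z≤n)

  ∣*-*∣≤ : ∀ a b c d → ∣ a * b - c * d ∣ ≤ ∣ a ∣ * ∣ b - d ∣ + ∣ a - c ∣ * ∣ d ∣
  ∣*-*∣≤ a b c d = begin
    ∣ a * b - c * d ∣                         ≡⟨ cong ∣_∣ (split a b c d) ⟩
    ∣ a * (b - d) + (a - c) * d ∣             ≤⟨ ∣p+q∣≤∣p∣+∣q∣ (a * (b - d)) ((a - c) * d) ⟩
    ∣ a * (b - d) ∣ + ∣ (a - c) * d ∣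
      ≡⟨ cong₂ _+_ (∣p*q∣≡∣p∣*∣q∣ a (b - d)) (∣p*q∣≡∣p∣*∣q∣ (a - c) d) ⟩
    ∣ a ∣ * ∣ b - d ∣ + ∣ a - c ∣ * ∣ d ∣     ∎
    where
    open ≤-Reasoning
    split : ∀ a b c d → a * b - c * d ≡ a * (b - d) + (a - c) * d
    split = solve-∀ ℚ-ring

  pow : ℚ → ℕ → ℚ
  pow p zero    = 1ℚ
  pow p (suc n) = p * pow p n

  ∣pow∣≤ : ∀ {p A} → ∣ p ∣ ≤ ⟦ A ⟧ → ∀ n → ∣ pow p n ∣ ≤ ⟦ A ℕ.^ n ⟧
  ∣pow∣≤         ∣p∣≤A zero    = ≤-reflexive (sym ⟦1⟧≡1)
  ∣pow∣≤ {p} {A} ∣p∣≤A (suc n) = subst₂ _≤_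
    (sym (∣p*q∣≡∣p∣*∣q∣ p (pow p n))) (sym (⟦⟧-* A (A ℕ.^ n)))
    (*-mono-≤ (0≤∣p∣ p) (0≤⟦⟧ (A ℕ.^ n)) ∣p∣≤A (∣pow∣≤ {p} {A} ∣p∣≤A n))

  -- The Lipschitz constant n A^(n - 1) of the n-th power on [-A, A], in the recursive form produced
  -- by the product rule.
  powLipschitz : ℕ → ℕ → ℕ
  powLipschitz A zero    = 0
  powLipschitz A (suc n) = A ℕ.* powLipschitz A n ℕ.+ A ℕ.^ n

  ∣pow-pow∣≤ : ∀ {p q A} → ∣ p ∣ ≤ ⟦ A ⟧ → ∣ q ∣ ≤ ⟦ A ⟧ → ∀ n →
    ∣ pow p n - pow q n ∣ ≤ ⟦ powLipschitz A n ⟧ * ∣ p - q ∣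
  ∣pow-pow∣≤ {p} {q} {A} ∣p∣≤A ∣q∣≤A zero    =
    ≤-reflexive (sym (trans (cong (_* ∣ p - q ∣) ⟦0⟧≡0) (*-zeroˡ ∣ p - q ∣)))
  ∣pow-pow∣≤ {p} {q} {A} ∣p∣≤A ∣q∣≤A (suc n) = begin
    ∣ p * pow p n - q * pow q n ∣
      ≤⟨ ∣*-*∣≤ p (pow p n) q (pow q n) ⟩
    ∣ p ∣ * ∣ pow p n - pow q n ∣ + ∣ p - q ∣ * ∣ pow q n ∣
      ≤⟨ +-mono-≤
        (*-mono-≤ (0≤∣p∣ p) (0≤* (0≤⟦⟧ D) (0≤∣p∣ (p - q))) ∣p∣≤A (∣pow-pow∣≤ ∣p∣≤A ∣q∣≤A n))
        (0≤⇒*-monoˡ-≤ ∣ p - q ∣ (0≤∣p∣ (p - q)) (∣pow∣≤ ∣q∣≤A n)) ⟩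
    ⟦ A ⟧ * (⟦ D ⟧ * ∣ p - q ∣) + ∣ p - q ∣ * ⟦ A ℕ.^ n ⟧
      ≡⟨ regroup ⟦ A ⟧ ⟦ D ⟧ ∣ p - q ∣ ⟦ A ℕ.^ n ⟧ ⟩
    (⟦ A ⟧ * ⟦ D ⟧ + ⟦ A ℕ.^ n ⟧) * ∣ p - q ∣
      ≡⟨ cong (λ r → (r + ⟦ A ℕ.^ n ⟧) * ∣ p - q ∣) (⟦⟧-* A D) ⟨
    (⟦ A ℕ.* D ⟧ + ⟦ A ℕ.^ n ⟧) * ∣ p - q ∣
      ≡⟨ cong (_* ∣ p - q ∣) (⟦⟧-+ (A ℕ.* D) (A ℕ.^ n)) ⟨
    ⟦ powLipschitz A (suc n) ⟧ * ∣ p - q ∣ ∎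
    where
    open ≤-Reasoning
    D : ℕ
    D = powLipschitz A n
    regroup : ∀ a d x b → a * (d * x) + x * b ≡ (a * d + b) * x
    regroup = solve-∀ ℚ-ring

  *-interchange : ∀ a b c d → (a * b) * (c * d) ≡ (a * c) * (b * d)
  *-interchange = solve-∀ ℚ-ring

  pow-* : ∀ p q n → pow (p * q) n ≡ pow p n * pow q n
  pow-* p q zero    = refl
  pow-* p q (suc n) = trans (cong (p * q *_) (pow-* p q n)) (*-interchange p q (pow p n) (pow q n))

  pow-ι : ∀ i n → pow (ι i) n ≡ ι (i ℤ.^ n)
  pow-ι i zero    = sym ⟦1⟧≡1
  pow-ι i (suc n) = trans (cong (ι i *_) (pow-ι i n)) (sym (ι-* i (i ℤ.^ n)))

  pow-⟦⟧ : ∀ m n → pow ⟦ m ⟧ n ≡ ⟦ m ℕ.^ n ⟧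
  pow-⟦⟧ m zero    = sym ⟦1⟧≡1
  pow-⟦⟧ m (suc n) = trans (cong (⟦ m ⟧ *_) (pow-⟦⟧ m n)) (sym (⟦⟧-* m (m ℕ.^ n)))

  pow-fraction : ∀ {p i q} m → p * ⟦ q ⟧ ≡ ι i → pow p m * ⟦ q ℕ.^ m ⟧ ≡ ι (i ℤ.^ m)
  pow-fraction {p} {i} {q} m p*q≡i = begin
    pow p m * ⟦ q ℕ.^ m ⟧    ≡⟨ cong (pow p m *_) (pow-⟦⟧ q m) ⟨
    pow p m * pow ⟦ q ⟧ m    ≡⟨ pow-* p ⟦ q ⟧ m ⟨
    pow (p * ⟦ q ⟧) m        ≡⟨ cong (λ r → pow r m) p*q≡i ⟩
    pow (ι i) m              ≡⟨ pow-ι i m ⟩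
    ι (i ℤ.^ m)              ∎
    where open ≡-Reasoning

  -- The product rule splits the error into two terms, and each of the last two hypotheses bounds
  -- one of them by 1 / W. In the application W is four times the power of the denominator to be
  -- beaten, so the total 2 / W is only half of what is allowed.
  productClose : ∀ {σ τ x y A} m W →
    ∣ σ ∣ ≤ 1ℚ → ∣ x ∣ ≤ ⟦ A ⟧ → ∣ y ∣ ≤ ⟦ A ⟧ →
    ∣ x - y ∣ * ⟦ powLipschitz A m ℕ.* W ⟧ ≤ 1ℚ → ∣ σ - τ ∣ * ⟦ A ℕ.^ m ℕ.* W ⟧ ≤ 1ℚ →
    ∣ σ * pow x m - τ * pow y m ∣ * ⟦ W ⟧ ≤ ⟦ 2 ⟧
  productClose {σ} {τ} {x} {y} {A} m W ∣σ∣≤1 ∣x∣≤A ∣y∣≤A x≈y σ≈τ = begin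
    ∣ σ * pow x m - τ * pow y m ∣ * ⟦ W ⟧
      ≤⟨ 0≤⇒*-monoʳ-≤ ⟦ W ⟧ (0≤⟦⟧ W) (∣*-*∣≤ σ (pow x m) τ (pow y m)) ⟩
    (∣ σ ∣ * ∣ pow x m - pow y m ∣ + ∣ σ - τ ∣ * ∣ pow y m ∣) * ⟦ W ⟧
      ≤⟨ 0≤⇒*-monoʳ-≤ ⟦ W ⟧ (0≤⟦⟧ W) (+-mono-≤
        (*-mono-≤ (0≤∣p∣ σ) (0≤* (0≤⟦⟧ D) (0≤∣p∣ (x - y))) ∣σ∣≤1 (∣pow-pow∣≤ ∣x∣≤A ∣y∣≤A m))
        (0≤⇒*-monoˡ-≤ ∣ σ - τ ∣ (0≤∣p∣ (σ - τ)) (∣pow∣≤ ∣y∣≤A m))) ⟩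
    (1ℚ * (⟦ D ⟧ * ∣ x - y ∣) + ∣ σ - τ ∣ * ⟦ A ℕ.^ m ⟧) * ⟦ W ⟧
      ≡⟨ regroup ⟦ D ⟧ ∣ x - y ∣ ∣ σ - τ ∣ ⟦ A ℕ.^ m ⟧ ⟦ W ⟧ ⟩
    ∣ x - y ∣ * (⟦ D ⟧ * ⟦ W ⟧) + ∣ σ - τ ∣ * (⟦ A ℕ.^ m ⟧ * ⟦ W ⟧)
      ≡⟨ cong₂ (λ u v → ∣ x - y ∣ * u + ∣ σ - τ ∣ * v) (⟦⟧-* D W) (⟦⟧-* (A ℕ.^ m) W) ⟨
    ∣ x - y ∣ * ⟦ D ℕ.* W ⟧ + ∣ σ - τ ∣ * ⟦ A ℕ.^ m ℕ.* W ⟧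
      ≤⟨ +-mono-≤ x≈y σ≈τ ⟩
    1ℚ + 1ℚ
      ≡⟨ 1+1≡⟦2⟧ ⟩
    ⟦ 2 ⟧ ∎
    where
    open ≤-Reasoning
    D : ℕ
    D = powLipschitz A m
    regroup : ∀ d u v a w → (1ℚ * (d * u) + v * a) * w ≡ u * (d * w) + v * (a * w)
    regroup = solve-∀ ℚ-ring

  -- The difference multiplied by m n is a nonzero integer, hence at least 1 in absolute value.
  fractionGap : ∀ {p q i j} m n → p * ⟦ m ⟧ ≡ ι i → q * ⟦ n ⟧ ≡ ι j → i ℤ.* + n ≢ j ℤ.* + m →
    1ℚ ≤ ∣ p - q ∣ * ⟦ m ℕ.* n ⟧
  fractionGap {p} {q} {i} {j} m n p*m≡i q*n≡j in≢jm = begin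
    1ℚ                                 ≡⟨ ⟦1⟧≡1 ⟨
    ⟦ 1 ⟧
      ≤⟨ ⟦⟧-mono-≤ (ℕ.n≢0⇒n>0 (λ eq → in≢jm (ℤ.i-j≡0⇒i≡j _ _ (ℤ.∣i∣≡0⇒i≡0 eq)))) ⟩
    ⟦ ℤ.∣ i ℤ.* + n ℤ.- j ℤ.* + m ∣ ⟧  ≡⟨ ∣p∣*⟦⟧ (p - q) (m ℕ.* n) difference ⟨
    ∣ p - q ∣ * ⟦ m ℕ.* n ⟧            ∎
    where
    open ≤-Reasoning
    regroup : ∀ p q m n → (p - q) * (m * n) ≡ p * m * n - q * n * m
    regroup = solve-∀ ℚ-ring
    difference : (p - q) * ⟦ m ℕ.* n ⟧ ≡ ι (i ℤ.* + n ℤ.- j ℤ.* + m)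
    difference = begin-equality
      (p - q) * ⟦ m ℕ.* n ⟧                  ≡⟨ cong ((p - q) *_) (⟦⟧-* m n) ⟩
      (p - q) * (⟦ m ⟧ * ⟦ n ⟧)              ≡⟨ regroup p q ⟦ m ⟧ ⟦ n ⟧ ⟩
      p * ⟦ m ⟧ * ⟦ n ⟧ - q * ⟦ n ⟧ * ⟦ m ⟧  ≡⟨ cong₂ (λ u v → u * ⟦ n ⟧ - v * ⟦ m ⟧) p*m≡i q*n≡j ⟩
      ι i * ⟦ n ⟧ - ι j * ⟦ m ⟧              ≡⟨ cong₂ _-_ (ι-* i (+ n)) (ι-* j (+ m)) ⟨
      ι (i ℤ.* + n) - ι (j ℤ.* + m)          ≡⟨ cong (λ u → ι (i ℤ.* + n) + u) (ι-neg (j ℤ.* + m)) ⟨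
      ι (i ℤ.* + n) + ι (ℤ.- (j ℤ.* + m))    ≡⟨ ι-+ (i ℤ.* + n) (ℤ.- (j ℤ.* + m)) ⟨
      ι (i ℤ.* + n ℤ.- j ℤ.* + m)            ∎

  reciprocal>0 : ∀ {w} W → w * ⟦ W ⟧ ≡ ⟦ 1 ⟧ → 0ℚ < w
  reciprocal>0 {w} W w*W≡1 = *-cancelʳ-<-nonNeg ⟦ W ⟧ {{⟦⟧-nonNeg W}}
    (subst₂ _<_ (trans ⟦0⟧≡0 (sym (*-zeroˡ ⟦ W ⟧))) (sym w*W≡1) (⟦⟧-mono-< (ℕ.s≤s ℕ.z≤n)))

  *-cancelʳ-⟦⟧ : ∀ {p q} n .{{_ : ℕ.NonZero n}} → p * ⟦ n ⟧ ≡ q * ⟦ n ⟧ → p ≡ q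
  *-cancelʳ-⟦⟧ n eq = ≤-antisym
    (*-cancelʳ-≤-pos ⟦ n ⟧ {{⟦⟧-pos n}} (≤-reflexive eq))
    (*-cancelʳ-≤-pos ⟦ n ⟧ {{⟦⟧-pos n}} (≤-reflexive (sym eq)))

  p≤∣p∣ : ∀ p → p ≤ ∣ p ∣
  p≤∣p∣ p with ≤-total 0ℚ p
  ... | inj₁ 0≤p = ≤-reflexive (sym (0≤p⇒∣p∣≡p 0≤p))
  ... | inj₂ p≤0 = ≤-trans p≤0 (0≤∣p∣ p)

-- The partial sums S, their tails and the limit σ

module Series where

  open import Data.Integer.Base using (+_)
  open import Data.Nat.Base as ℕ using (ℕ; zero; suc)
  import Data.Nat.Properties as ℕ
  open import Data.Product.Base using (∃-syntax; _×_; _,_; proj₁; proj₂)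
  open import Data.Rational.Base
  open import Data.Rational.Properties
  open import Relation.Binary.PropositionalEquality
  open import Tactic.RingSolver using (solve-∀)
  open import Defs using (IsCauchy; ℝ; mkℝ; seq)
  open Arithmetic
  open Rationals

  s-cong : ∀ {c d} → (∀ k → c k ≡ d k) → ∀ k → s c k ≡ s d k
  s-cong c≗d zero    = refl
  s-cong c≗d (suc k) =
    cong₂ (λ a b → a ℕ.* (t k ℕ.^ k ℕ.* nextPrime (t k)) ℕ.+ b) (s-cong c≗d k) (c≗d k)

  abstract
    S : (ℕ → ℕ) → ℕ → ℚ
    S c k = + s c k / t k

    r : ℕ → ℚ
    r k = + 1 / t k

    S-* : ∀ c k → S c k * ⟦ t k ⟧ ≡ ⟦ s c k ⟧
    S-* c k = /-*-cancel (+ s c k) (t k)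

    r-* : ∀ k → r k * ⟦ t k ⟧ ≡ 1ℚ
    r-* k = trans (/-*-cancel (+ 1) (t k)) ⟦1⟧≡1

    S-zero : ∀ c → S c 0 ≡ 0ℚ
    S-zero c = 0/n≡0 (t 0)

    S-cong : ∀ {c d} → (∀ k → c k ≡ d k) → ∀ k → S c k ≡ S d k
    S-cong c≗d k = cong (λ i → + i / t k) (s-cong c≗d k)

  S-suc : ∀ c k → S c (suc k) - S c k ≡ ⟦ c k ⟧ * r (suc k)
  S-suc c k = *-cancelʳ-⟦⟧ (t (suc k)) (begin
    (S c (suc k) - S c k) * ⟦ t (suc k) ⟧                 ≡⟨ distrib (S c (suc k)) (S c k) ⟦ t (suc k) ⟧ ⟩
    S c (suc k) * ⟦ t (suc k) ⟧ - S c k * ⟦ t (suc k) ⟧   ≡⟨ cong₂ _-_ (S-* c (suc k)) old ⟩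
    ⟦ s c k ℕ.* u ℕ.+ c k ⟧ - ⟦ s c k ⟧ * ⟦ u ⟧
      ≡⟨ cong (_- ⟦ s c k ⟧ * ⟦ u ⟧) (⟦⟧-+ (s c k ℕ.* u) (c k)) ⟩
    ⟦ s c k ℕ.* u ⟧ + ⟦ c k ⟧ - ⟦ s c k ⟧ * ⟦ u ⟧
      ≡⟨ cong (λ v → v + ⟦ c k ⟧ - ⟦ s c k ⟧ * ⟦ u ⟧) (⟦⟧-* (s c k) u) ⟩
    ⟦ s c k ⟧ * ⟦ u ⟧ + ⟦ c k ⟧ - ⟦ s c k ⟧ * ⟦ u ⟧       ≡⟨ cancel (⟦ s c k ⟧ * ⟦ u ⟧) ⟦ c k ⟧ ⟩
    ⟦ c k ⟧ * 1ℚ                                          ≡⟨ cong (⟦ c k ⟧ *_) (r-* (suc k)) ⟨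
    ⟦ c k ⟧ * (r (suc k) * ⟦ t (suc k) ⟧)                 ≡⟨ *-assoc ⟦ c k ⟧ (r (suc k)) ⟦ t (suc k) ⟧ ⟨
    ⟦ c k ⟧ * r (suc k) * ⟦ t (suc k) ⟧                   ∎)
    where
    open ≡-Reasoning
    u : ℕ
    u = t k ℕ.^ k ℕ.* nextPrime (t k)
    distrib : ∀ a b x → (a - b) * x ≡ a * x - b * x
    distrib = solve-∀ ℚ-ring
    cancel : ∀ a b → a + b - a ≡ b * 1ℚ
    cancel = solve-∀ ℚ-ring
    old : S c k * ⟦ t (suc k) ⟧ ≡ ⟦ s c k ⟧ * ⟦ u ⟧
    old = begin
      S c k * ⟦ t (suc k) ⟧
        ≡⟨ cong (λ v → S c k * ⟦ v ⟧) (trans (t-suc k) (ℕ.*-assoc (t k) (t k ℕ.^ k) (nextPrime (t k)))) ⟩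
      S c k * ⟦ t k ℕ.* u ⟧       ≡⟨ cong (S c k *_) (⟦⟧-* (t k) u) ⟩
      S c k * (⟦ t k ⟧ * ⟦ u ⟧)   ≡⟨ *-assoc (S c k) ⟦ t k ⟧ ⟦ u ⟧ ⟨
      S c k * ⟦ t k ⟧ * ⟦ u ⟧     ≡⟨ cong (_* ⟦ u ⟧) (S-* c k) ⟩
      ⟦ s c k ⟧ * ⟦ u ⟧           ∎

  S-suc′ : ∀ c k → S c (suc k) ≡ ⟦ c k ⟧ * r (suc k) + S c k
  S-suc′ c k = trans (split (S c (suc k)) (S c k)) (cong (_+ S c k) (S-suc c k))
    where
    split : ∀ a b → a ≡ (a - b) + b
    split = solve-∀ ℚ-ring

  0<r : ∀ k → 0ℚ < r k
  0<r k = *-cancelʳ-<-nonNeg ⟦ t k ⟧ {{⟦⟧-nonNeg (t k)}} (begin-strict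
    0ℚ * ⟦ t k ⟧  ≡⟨ *-zeroˡ ⟦ t k ⟧ ⟩
    0ℚ            <⟨ positive⁻¹ 1ℚ ⟩
    1ℚ            ≡⟨ r-* k ⟨
    r k * ⟦ t k ⟧ ∎)
    where open ≤-Reasoning

  0≤r : ∀ k → 0ℚ ≤ r k
  0≤r k = <⇒≤ (0<r k)

  8r≤r : ∀ k → ⟦ 8 ⟧ * r (suc k) ≤ r k
  8r≤r k = *-cancelʳ-≤-pos ⟦ t k ⟧ {{⟦⟧-pos (t k)}} (begin
    ⟦ 8 ⟧ * r (suc k) * ⟦ t k ⟧   ≡⟨ regroup ⟦ 8 ⟧ (r (suc k)) ⟦ t k ⟧ ⟩
    r (suc k) * (⟦ 8 ⟧ * ⟦ t k ⟧) ≡⟨ cong (r (suc k) *_) (⟦⟧-* 8 (t k)) ⟨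
    r (suc k) * ⟦ 8 ℕ.* t k ⟧     ≤⟨ 0≤⇒*-monoˡ-≤ (r (suc k)) (0≤r (suc k)) (⟦⟧-mono-≤ (8t≤t[1+k] k)) ⟩
    r (suc k) * ⟦ t (suc k) ⟧     ≡⟨ r-* (suc k) ⟩
    1ℚ                            ≡⟨ r-* k ⟨
    r k * ⟦ t k ⟧                 ∎)
    where
    open ≤-Reasoning
    regroup : ∀ a b c → a * b * c ≡ b * (a * c)
    regroup = solve-∀ ℚ-ring

  module _ {c : ℕ → ℕ} (c-digits : ∀ k → IsDigit (c k)) where

    private
      -- The bound is strengthened by the unspent allowance `⟦ 3 ⟧ * r (suc n)` so that the
      -- induction closes: the next term spends at most 2 of these 3 parts, and the part left over
      -- is at least `⟦ 8 ⟧ * r (2 ℕ.+ n)`, enough for the next allowance.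
      tail : ∀ {k n} → k ℕ.≤′ n → 0ℚ ≤ S c n - S c k × S c n - S c k + ⟦ 3 ⟧ * r (suc n) ≤ ⟦ 3 ⟧ * r (suc k)
      tail {k} ℕ.≤′-refl = ≤-reflexive (sym (+-inverseʳ (S c k)))
        , ≤-reflexive (trans (cong (_+ ⟦ 3 ⟧ * r (suc k)) (+-inverseʳ (S c k))) (+-identityˡ (⟦ 3 ⟧ * r (suc k))))
      tail {k} (ℕ.≤′-step {n} k≤′n) with tail k≤′n
      ... | lower , upper = (begin
          0ℚ
            ≤⟨ +-mono-≤ (0≤* (0≤⟦⟧ (c n)) (0≤r (suc n))) lower ⟩
          ⟦ c n ⟧ * r (suc n) + (S c n - S c k)         ≡⟨ cong (_+ (S c n - S c k)) (S-suc c n) ⟨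
          (S c (suc n) - S c n) + (S c n - S c k)       ≡⟨ telescope (S c (suc n)) (S c n) (S c k) ⟩
          S c (suc n) - S c k                           ∎)
        , (begin
          S c (suc n) - S c k + ⟦ 3 ⟧ * r (2 ℕ.+ n)
            ≤⟨ +-monoʳ-≤ (S c (suc n) - S c k) (0≤⇒*-monoʳ-≤ (r (2 ℕ.+ n)) (0≤r (2 ℕ.+ n))
                (⟦⟧-mono-≤ {3} {8} (ℕ.s≤s (ℕ.s≤s (ℕ.s≤s ℕ.z≤n))))) ⟩
          S c (suc n) - S c k + ⟦ 8 ⟧ * r (2 ℕ.+ n)
            ≤⟨ +-monoʳ-≤ (S c (suc n) - S c k) (8r≤r (suc n)) ⟩
          S c (suc n) - S c k + r (suc n)
            ≡⟨ regroup (S c (suc n)) (S c n) (S c k) (r (suc n)) ⟩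
          (S c (suc n) - S c n) + (S c n - S c k + r (suc n))
            ≡⟨ cong (_+ (S c n - S c k + r (suc n))) (S-suc c n) ⟩
          ⟦ c n ⟧ * r (suc n) + (S c n - S c k + r (suc n))
            ≤⟨ +-monoˡ-≤ (S c n - S c k + r (suc n)) (0≤⇒*-monoʳ-≤ (r (suc n)) (0≤r (suc n))
                (⟦⟧-mono-≤ (ℕ.s≤s⁻¹ (digit<3 (c-digits n))))) ⟩
          ⟦ 2 ⟧ * r (suc n) + (S c n - S c k + r (suc n))
            ≡⟨ collect (r (suc n)) (S c n - S c k) ⟩
          S c n - S c k + ⟦ 3 ⟧ * r (suc n)
            ≤⟨ upper ⟩
          ⟦ 3 ⟧ * r (suc k) ∎)
        where
        open ≤-Reasoning
        telescope : ∀ p q r → (p - q) + (q - r) ≡ p - r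
        telescope = solve-∀ ℚ-ring
        regroup : ∀ a b c d → a - c + d ≡ (a - b) + (b - c + d)
        regroup = solve-∀ ℚ-ring
        1+2≡3 : 1ℚ + ⟦ 2 ⟧ ≡ ⟦ 3 ⟧
        1+2≡3 = sym (trans (⟦⟧-+ 1 2) (cong (_+ ⟦ 2 ⟧) ⟦1⟧≡1))
        collect : ∀ x y → ⟦ 2 ⟧ * x + (y + x) ≡ y + ⟦ 3 ⟧ * x
        collect x y = trans (lemma ⟦ 2 ⟧ x y) (cong (λ z → y + z * x) 1+2≡3)
          where
          lemma : ∀ a x y → a * x + (y + x) ≡ y + (1ℚ + a) * x
          lemma = solve-∀ ℚ-ring

    S-mono-≤ : ∀ {k n} → k ℕ.≤ n → S c k ≤ S c n
    S-mono-≤ {k} {n} k≤n = subst₂ _≤_ (+-identityˡ (S c k)) (cancel (S c n) (S c k))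
      (+-monoˡ-≤ (S c k) (proj₁ (tail (ℕ.≤⇒≤′ k≤n))))
      where
      cancel : ∀ a b → (a - b) + b ≡ a
      cancel = solve-∀ ℚ-ring

    0≤S-S : ∀ {k n} → k ℕ.≤ n → 0ℚ ≤ S c n - S c k
    0≤S-S k≤n = proj₁ (tail (ℕ.≤⇒≤′ k≤n))

    S-S≤3r : ∀ {k n} → k ℕ.≤ n → S c n - S c k ≤ ⟦ 3 ⟧ * r (suc k)
    S-S≤3r {k} {n} k≤n = ≤-trans
      (subst (_≤ S c n - S c k + ⟦ 3 ⟧ * r (suc n)) (+-identityʳ (S c n - S c k))
        (+-monoʳ-≤ (S c n - S c k) (0≤* (0≤⟦⟧ 3) (0≤r (suc n)))))
      (proj₂ (tail (ℕ.≤⇒≤′ k≤n)))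

    S-close : ∀ {k n} → k ℕ.≤ n → ∀ X → 3 ℕ.* X ℕ.≤ t (suc k) → ∣ S c n - S c k ∣ * ⟦ X ⟧ ≤ 1ℚ
    S-close {k} {n} k≤n X 3X≤t = begin
      ∣ S c n - S c k ∣ * ⟦ X ⟧   ≡⟨ cong (_* ⟦ X ⟧) (0≤p⇒∣p∣≡p (0≤S-S k≤n)) ⟩
      (S c n - S c k) * ⟦ X ⟧     ≤⟨ 0≤⇒*-monoʳ-≤ ⟦ X ⟧ (0≤⟦⟧ X) (S-S≤3r k≤n) ⟩
      ⟦ 3 ⟧ * r (suc k) * ⟦ X ⟧   ≡⟨ regroup ⟦ 3 ⟧ (r (suc k)) ⟦ X ⟧ ⟩
      r (suc k) * (⟦ 3 ⟧ * ⟦ X ⟧) ≡⟨ cong (r (suc k) *_) (⟦⟧-* 3 X) ⟨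
      r (suc k) * ⟦ 3 ℕ.* X ⟧     ≤⟨ 0≤⇒*-monoˡ-≤ (r (suc k)) (0≤r (suc k)) (⟦⟧-mono-≤ 3X≤t) ⟩
      r (suc k) * ⟦ t (suc k) ⟧   ≡⟨ r-* (suc k) ⟩
      1ℚ                          ∎
      where
      open ≤-Reasoning
      regroup : ∀ a b c → a * b * c ≡ b * (a * c)
      regroup = solve-∀ ℚ-ring

    ∣S∣≤1 : ∀ n → ∣ S c n ∣ ≤ 1ℚ
    ∣S∣≤1 n = subst (_≤ 1ℚ) eq
      (S-close {0} {n} ℕ.z≤n 1 (ℕ.≤-trans (ℕ.s≤s (ℕ.s≤s (ℕ.s≤s ℕ.z≤n))) (t≥8 1)))
      where
      open ≡-Reasoning
      eq : ∣ S c n - S c 0 ∣ * ⟦ 1 ⟧ ≡ ∣ S c n ∣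
      eq = begin
        ∣ S c n - S c 0 ∣ * ⟦ 1 ⟧
          ≡⟨ trans (cong (∣ S c n - S c 0 ∣ *_) ⟦1⟧≡1) (*-identityʳ ∣ S c n - S c 0 ∣) ⟩
        ∣ S c n - S c 0 ∣           ≡⟨ cong (λ p → ∣ S c n - p ∣) (S-zero c) ⟩
        ∣ S c n - 0ℚ ∣              ≡⟨ cong ∣_∣ (p-0≡p (S c n)) ⟩
        ∣ S c n ∣                   ∎

    S-cauchy : IsCauchy (S c)
    S-cauchy ε 0<ε with archimedean ε 0<ε
    ... | a , 1<εa = k , λ m n k≤m k≤n → *-cancelʳ-<-nonNeg ⟦ a ⟧ {{⟦⟧-nonNeg a}}
      (≤-<-trans (close k≤m k≤n) 1<εa)
      where
      open ≤-Reasoning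
      k : ℕ
      -- Since `k` is below `t (suc k)`, all later sums are within 1 / (2 a) of `S c k`, hence
      -- within 1 / a of each other.
      k = 3 ℕ.* (2 ℕ.* a)
      3[2a]≤t : 3 ℕ.* (2 ℕ.* a) ℕ.≤ t (suc k)
      3[2a]≤t = ℕ.≤-trans (ℕ.n≤1+n k) (ℕ.<⇒≤ (k<t (suc k)))
      double : ∀ x y z → (x + y) * z * ⟦ 2 ⟧ ≡ x * (⟦ 2 ⟧ * z) + y * (⟦ 2 ⟧ * z)
      double x y z = lemma ⟦ 2 ⟧ x y z
        where
        lemma : ∀ a x y z → (x + y) * z * a ≡ x * (a * z) + y * (a * z)
        lemma = solve-∀ ℚ-ring
      close : ∀ {m n} → k ℕ.≤ m → k ℕ.≤ n → ∣ S c m - S c n ∣ * ⟦ a ⟧ ≤ 1ℚ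
      close {m} {n} k≤m k≤n = *-cancelʳ-≤-pos ⟦ 2 ⟧ {{⟦⟧-pos 2}} (begin
        ∣ S c m - S c n ∣ * ⟦ a ⟧ * ⟦ 2 ⟧
          ≤⟨ 0≤⇒*-monoʳ-≤ ⟦ 2 ⟧ (0≤⟦⟧ 2) (0≤⇒*-monoʳ-≤ ⟦ a ⟧ (0≤⟦⟧ a)
               (∣p-r∣≤∣p-q∣+∣q-r∣ (S c m) (S c k) (S c n))) ⟩
        (∣ S c m - S c k ∣ + ∣ S c k - S c n ∣) * ⟦ a ⟧ * ⟦ 2 ⟧
          ≡⟨ cong (λ p → (∣ S c m - S c k ∣ + p) * ⟦ a ⟧ * ⟦ 2 ⟧) (∣p-q∣≡∣q-p∣ (S c k) (S c n)) ⟩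
        (∣ S c m - S c k ∣ + ∣ S c n - S c k ∣) * ⟦ a ⟧ * ⟦ 2 ⟧
          ≡⟨ double ∣ S c m - S c k ∣ ∣ S c n - S c k ∣ ⟦ a ⟧ ⟩
        ∣ S c m - S c k ∣ * (⟦ 2 ⟧ * ⟦ a ⟧) + ∣ S c n - S c k ∣ * (⟦ 2 ⟧ * ⟦ a ⟧)
          ≡⟨ cong (λ p → ∣ S c m - S c k ∣ * p + ∣ S c n - S c k ∣ * p) (⟦⟧-* 2 a) ⟨
        ∣ S c m - S c k ∣ * ⟦ 2 ℕ.* a ⟧ + ∣ S c n - S c k ∣ * ⟦ 2 ℕ.* a ⟧
          ≤⟨ +-mono-≤ (S-close k≤m (2 ℕ.* a) 3[2a]≤t) (S-close k≤n (2 ℕ.* a) 3[2a]≤t) ⟩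
        1ℚ + 1ℚ     ≡⟨ trans 1+1≡⟦2⟧ (sym (*-identityˡ ⟦ 2 ⟧)) ⟩
        1ℚ * ⟦ 2 ⟧  ∎)

    -- Abstract, since otherwise the type checker unfolds the proof of S-cauchy when it compares
    -- types that mention σ.
    abstract
      σ : ℝ
      σ = mkℝ (S c) S-cauchy

      seq-σ : ∀ n → seq σ n ≡ S c n
      seq-σ n = refl

-- Rational approximations to ξ, and from them to σ ξ^m

module Approximation where

  open import Data.Integer.Base as ℤ using (ℤ; 0ℤ; +_)
  import Data.Integer.Properties as ℤ
  open import Data.List.Base using (List; []; _++_; map; upTo; cartesianProduct)
  open import Data.List.Membership.Propositional using (_∈_)
  open import Data.List.Membership.Propositional.Properties
    using (∈-map⁺; ∈-++⁺ˡ; ∈-++⁺ʳ; ∈-upTo⁺; ∈-cartesianProduct⁺)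
  open import Data.Nat.Base as ℕ using (ℕ; suc; s≤s; z≤n)
  import Data.Nat.Properties as ℕ
  open import Data.Nat.Tactic.RingSolver using () renaming (solve-∀ to ℕ-solve-∀)
  open import Data.Product.Base using (∃-syntax; _×_; _,_; proj₁; proj₂)
  open import Data.Rational.Base
  open import Data.Rational.Properties
  open import Relation.Binary.PropositionalEquality
  open import Relation.Nullary using (yes; no)
  open import Tactic.RingSolver using (solve-∀)
  import Defs as R
  open import Defs using (ℝ; seq; cauchy; Liouville; LiouvilleApproximation; fromℚ; 0ℝ)
  open Arithmetic
  open Rationals
  open Series

  Eventually : (ℕ → Set) → Set
  Eventually P = ∃[ N ] ∀ n → N ℕ.≤ n → P n

  ev-map : ∀ {P Q : ℕ → Set} → (∀ n → P n → Q n) → Eventually P → Eventually Q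
  ev-map f (N , h) = N , λ n N≤n → f n (h n N≤n)

  ev-zip : ∀ {P Q T : ℕ → Set} → (∀ n → P n → Q n → T n) → Eventually P → Eventually Q → Eventually T
  ev-zip f (M , g) (N , h) = M ℕ.⊔ N , λ n M⊔N≤n →
    f n (g n (ℕ.m⊔n≤o⇒m≤o M N M⊔N≤n)) (h n (ℕ.m⊔n≤o⇒n≤o M N M⊔N≤n))

  ev-extract : ∀ {P : Set} → Eventually (λ _ → P) → P
  ev-extract (N , h) = h N ℕ.≤-refl

  bounded : ∀ x → ∃[ A ] Eventually (λ n → ∣ seq x n ∣ ≤ ⟦ A ⟧)
  bounded x with cauchy x 1ℚ (positive⁻¹ 1ℚ)
  ... | N , close with ≤⟦⟧ (1ℚ + ∣ seq x N ∣)
  ... | A , ≤A = A , N , λ n N≤n → begin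
    ∣ seq x n ∣                       ≤⟨ ∣p∣≤∣p-q∣+∣q∣ (seq x n) (seq x N) ⟩
    ∣ seq x n - seq x N ∣ + ∣ seq x N ∣ ≤⟨ +-monoˡ-≤ ∣ seq x N ∣ (<⇒≤ (close n N N≤n ℕ.≤-refl)) ⟩
    1ℚ + ∣ seq x N ∣                  ≤⟨ ≤A ⟩
    ⟦ A ⟧                             ∎
    where open ≤-Reasoning

  p<p+q : ∀ {p q} → 0ℚ < q → p < p + q
  p<p+q {p} {q} 0<q = subst (_< p + q) (+-identityʳ p) (+-monoʳ-< p 0<q)

  close⇒≤ : ∀ {ξ N p q} → LiouvilleApproximation ξ N (p , q) →
    ∃[ y ] y * ⟦ q ⟧ ≡ ι p × Eventually (λ n → ∣ seq ξ n - y ∣ * ⟦ q ℕ.^ N ⟧ ≤ 1ℚ)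
  close⇒≤ {ξ} {N} {p} {q} approx = p / q , /-*-cancel p q , close≤1 close
    where
    open LiouvilleApproximation approx using (close; q≢0; q^N≢0)
    close≤1 : R._<_ R.∣ ξ R.- fromℚ (p / q) ∣ (fromℚ (+ 1 / (q ℕ.^ N))) →
      Eventually (λ n → ∣ seq ξ n - p / q ∣ * ⟦ q ℕ.^ N ⟧ ≤ 1ℚ)
    close≤1 (ε , 0<ε , ev) = ev-map (λ n h → subst (∣ seq ξ n - p / q ∣ * ⟦ q ℕ.^ N ⟧ ≤_)
      (trans (/-*-cancel (+ 1) (q ℕ.^ N)) ⟦1⟧≡1)
      (0≤⇒*-monoʳ-≤ ⟦ q ℕ.^ N ⟧ (0≤⟦⟧ (q ℕ.^ N)) (<⇒≤ (<-trans (p<p+q {∣ seq ξ n - p / q ∣} 0<ε) h)))) ev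

  integersUpTo : ℕ → List ℤ
  integersUpTo B = map +_ (upTo (suc B)) ++ map ℤ.-[1+_] (upTo (suc B))

  ∈-integersUpTo : ∀ {i B} → ℤ.∣ i ∣ ℕ.≤ B → i ∈ integersUpTo B
  ∈-integersUpTo {+ n}          n≤B   = ∈-++⁺ˡ (∈-map⁺ +_ (∈-upTo⁺ (s≤s n≤B)))
  ∈-integersUpTo {ℤ.-[1+ n ]} {B} 1+n≤B = ∈-++⁺ʳ (map +_ (upTo (suc B)))
    (∈-map⁺ ℤ.-[1+_] (∈-upTo⁺ (ℕ.m≤n⇒m≤1+n 1+n≤B)))

  -- Here q can be made as large as desired and p is nonzero. The bound A is a parameter,
  -- independent of N and Q, because the threshold for q is itself computed from A.
  record PowerApproximation (x : ℝ) (A N Q : ℕ) : Set where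
    field
      p    : ℤ
      q    : ℕ
      y    : ℚ
      y*q≡p : y * ⟦ q ⟧ ≡ ι p
      p≢0  : p ≢ 0ℤ
      Q≤q  : Q ℕ.≤ q
      2≤q  : 2 ℕ.≤ q
      ∣y∣≤ : ∣ y ∣ ≤ ⟦ A ⟧
      close : Eventually (λ n → ∣ seq x n - y ∣ * ⟦ q ℕ.^ N ⟧ ≤ 1ℚ)

  ∣p∣≤∣q-p∣+∣q∣ : ∀ p q → ∣ p ∣ ≤ ∣ q - p ∣ + ∣ q ∣
  ∣p∣≤∣q-p∣+∣q∣ p q = subst (λ z → ∣ p ∣ ≤ z + ∣ q ∣) (∣p-q∣≡∣q-p∣ p q) (∣p∣≤∣p-q∣+∣q∣ p q)

  -- A nonzero fraction y with denominator q has absolute value at least u = 1 / q; the triangle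
  -- inequality passes this on to x.
  reciprocal≤ : ∀ {u y p q} .{{_ : ℕ.NonZero q}} x →
    p ≢ 0ℤ → y * ⟦ q ⟧ ≡ ι p → u * ⟦ q ⟧ ≡ ⟦ 1 ⟧ → u ≤ ∣ x - y ∣ + ∣ x ∣
  reciprocal≤ {u} {y} {p} {q} x p≢0 y*q≡p u*q≡1 = *-cancelʳ-≤-pos ⟦ q ⟧ {{⟦⟧-pos q}} (begin
    u * ⟦ q ⟧                     ≡⟨ u*q≡1 ⟩
    ⟦ 1 ⟧                         ≤⟨ ⟦⟧-mono-≤ (ℕ.n≢0⇒n>0 (λ ∣p∣≡0 → p≢0 (ℤ.∣i∣≡0⇒i≡0 ∣p∣≡0))) ⟩
    ⟦ ℤ.∣ p ∣ ⟧                   ≡⟨ ∣p∣*⟦⟧ y q y*q≡p ⟨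
    ∣ y ∣ * ⟦ q ⟧                 ≤⟨ 0≤⇒*-monoʳ-≤ ⟦ q ⟧ (0≤⟦⟧ q) (∣p∣≤∣q-p∣+∣q∣ y x) ⟩
    (∣ x - y ∣ + ∣ x ∣) * ⟦ q ⟧   ∎)
    where open ≤-Reasoning

  -- One approximation p / q with N = 1 suffices. If p = 0, the clause `nonzero` separates ξ from 0;
  -- otherwise p / q is at least 1 / q in size while ξ is closer to it than 1 / q. The bound serves
  -- to exclude zero numerators, for which the prime argument says nothing.
  liouville≢0 : ∀ {ξ} → Liouville ξ → ∃[ D ] Eventually (λ n → 1ℚ < ∣ seq ξ n ∣ * ⟦ D ⟧)
  liouville≢0 {ξ} liouville with liouville 1 ℕ.≤-refl []
  ... | (p , q) , _ , approx = apart⇒ (∃apart p approx)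
    where
    ∃apart : ∀ p → LiouvilleApproximation ξ 1 (p , q) →
      ∃[ ε ] 0ℚ < ε × Eventually (λ n → ε < ∣ seq ξ n ∣)
    ∃apart p approx with p ℤ.≟ 0ℤ
    ... | yes refl = apart₀ nonzero
      where
      open LiouvilleApproximation approx using (nonzero; q≢0)
      apart₀ : R._<_ 0ℝ R.∣ ξ R.- fromℚ (0ℤ / q) ∣ →
        ∃[ ε ] 0ℚ < ε × Eventually (λ n → ε < ∣ seq ξ n ∣)
      apart₀ (ε , 0<ε , ev) = ε , 0<ε , ev-map (λ n → subst₂ _<_ (+-identityˡ ε)
        (cong ∣_∣ (trans (cong (λ z → seq ξ n - z) (0/n≡0 q)) (p-0≡p (seq ξ n))))) ev
    ... | no p≢0 = apart₁ close
      where
      open LiouvilleApproximation approx using (close; q≢0; q^N≢0)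
      apart₁ : R._<_ R.∣ ξ R.- fromℚ (p / q) ∣ (fromℚ (+ 1 / (q ℕ.^ 1))) →
        ∃[ ε ] 0ℚ < ε × Eventually (λ n → ε < ∣ seq ξ n ∣)
      apart₁ (ε , 0<ε , ev) = ε , 0<ε , ev-map (λ n h → +-cancelˡ-< ∣ seq ξ n - p / q ∣ (<-≤-trans h (1/q≤ n))) ev
        where
        open ≡-Reasoning
        1/q≤ : ∀ n → + 1 / (q ℕ.^ 1) ≤ ∣ seq ξ n - p / q ∣ + ∣ seq ξ n ∣
        1/q≤ n = reciprocal≤ (seq ξ n) p≢0 (/-*-cancel p q) (begin
          + 1 / (q ℕ.^ 1) * ⟦ q ⟧       ≡⟨ cong (λ k → + 1 / (q ℕ.^ 1) * ⟦ k ⟧) (ℕ.*-identityʳ q) ⟨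
          + 1 / (q ℕ.^ 1) * ⟦ q ℕ.^ 1 ⟧ ≡⟨ /-*-cancel (+ 1) (q ℕ.^ 1) ⟩
          ⟦ 1 ⟧                         ∎)
    apart⇒ : ∃[ ε ] 0ℚ < ε × Eventually (λ n → ε < ∣ seq ξ n ∣) →
      ∃[ D ] Eventually (λ n → 1ℚ < ∣ seq ξ n ∣ * ⟦ D ⟧)
    apart⇒ (ε , 0<ε , ev) with archimedean ε 0<ε
    ... | D , 1<εD = D , ev-map (λ n ε<∣ξ∣ →
      <-≤-trans 1<εD (0≤⇒*-monoʳ-≤ ⟦ D ⟧ (0≤⟦⟧ D) (<⇒≤ ε<∣ξ∣))) ev

  -- For each bound on q only finitely many p/q are near ξ; InfinitelyMany supplies one outside them.
  powerApproximation : ∀ {ξ} → Liouville ξ →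
    ∃[ A ] Eventually (λ n → ∣ seq ξ n ∣ ≤ ⟦ A ⟧) × (∀ N Q → 1 ℕ.≤ N → PowerApproximation ξ A N Q)
  powerApproximation {ξ} liouville = suc A₀
    , ev-map (λ n ∣ξ∣≤ → ≤-trans ∣ξ∣≤ (⟦⟧-mono-≤ (ℕ.n≤1+n A₀))) ∣ξ∣≤A₀ , approximation
    where
    open ≤-Reasoning
    A₀ D : ℕ
    A₀ = proj₁ (bounded ξ)
    D  = proj₁ (liouville≢0 liouville)
    ∣ξ∣≤A₀ : Eventually (λ n → ∣ seq ξ n ∣ ≤ ⟦ A₀ ⟧)
    ∣ξ∣≤A₀ = proj₂ (bounded ξ)
    ξ≢0 : Eventually (λ n → 1ℚ < ∣ seq ξ n ∣ * ⟦ D ⟧)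
    ξ≢0 = proj₂ (liouville≢0 liouville)
    approximation : ∀ N Q → 1 ℕ.≤ N → PowerApproximation ξ (suc A₀) N Q
    approximation N Q₀ 1≤N
      with liouville N 1≤N (cartesianProduct (integersUpTo (suc A₀ ℕ.* (Q₀ ℕ.⊔ D))) (upTo (Q₀ ℕ.⊔ D)))
    ... | (p , q) , pq∉list , approx with close⇒≤ approx
    ... | y , y*q≡p , close = record
      { p = p ; q = q ; y = y ; y*q≡p = y*q≡p ; p≢0 = p≢0 ; Q≤q = ℕ.≤-trans (ℕ.m≤m⊔n Q₀ D) Q≤q
      ; 2≤q = LiouvilleApproximation.q≥2 approx ; ∣y∣≤ = ∣y∣≤ ; close = close }
      where
      Q : ℕ
      Q = Q₀ ℕ.⊔ D
      q≢0 : ℕ.NonZero q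
      q≢0 = LiouvilleApproximation.q≢0 approx
      1≤q^N : 1 ℕ.≤ q ℕ.^ N
      1≤q^N = ℕ.m^n>0 q {{q≢0}} N
      q≤q^N : q ℕ.≤ q ℕ.^ N
      q≤q^N = subst (ℕ._≤ q ℕ.^ N) (ℕ.*-identityʳ q) (ℕ.^-monoʳ-≤ q {{q≢0}} 1≤N)
      ∣y∣≤ : ∣ y ∣ ≤ ⟦ suc A₀ ⟧
      ∣y∣≤ = ev-extract (ev-zip (λ n close ∣ξ∣≤A₀ → begin
        ∣ y ∣                         ≤⟨ ∣p∣≤∣q-p∣+∣q∣ y (seq ξ n) ⟩
        ∣ seq ξ n - y ∣ + ∣ seq ξ n ∣
          ≤⟨ +-mono-≤ (subst (_≤ 1ℚ)
              (trans (cong (∣ seq ξ n - y ∣ *_) ⟦1⟧≡1) (*-identityʳ ∣ seq ξ n - y ∣))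
              (scale-≤ (0≤∣p∣ (seq ξ n - y)) 1≤q^N close)) ∣ξ∣≤A₀ ⟩
        1ℚ + ⟦ A₀ ⟧                   ≡⟨ trans (⟦⟧-+ 1 A₀) (cong (_+ ⟦ A₀ ⟧) ⟦1⟧≡1) ⟨
        ⟦ suc A₀ ⟧                    ∎) close ∣ξ∣≤A₀)
      Q≤q : Q ℕ.≤ q
      Q≤q = ℕ.≮⇒≥ λ q<Q → pq∉list (∈-cartesianProduct⁺ (∈-integersUpTo (∣p∣≤ q<Q)) (∈-upTo⁺ q<Q))
        where
        ∣p∣≤ : q ℕ.< Q → ℤ.∣ p ∣ ℕ.≤ suc A₀ ℕ.* Q
        ∣p∣≤ q<Q = ℕ.≤-trans (⟦⟧-cancel-≤ (begin
          ⟦ ℤ.∣ p ∣ ⟧          ≡⟨ ∣p∣*⟦⟧ y q y*q≡p ⟨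
          ∣ y ∣ * ⟦ q ⟧        ≤⟨ 0≤⇒*-monoʳ-≤ ⟦ q ⟧ (0≤⟦⟧ q) ∣y∣≤ ⟩
          ⟦ suc A₀ ⟧ * ⟦ q ⟧   ≡⟨ ⟦⟧-* (suc A₀) q ⟨
          ⟦ suc A₀ ℕ.* q ⟧     ∎)) (ℕ.*-monoʳ-≤ (suc A₀) (ℕ.<⇒≤ q<Q))
      -- With p = 0 the approximation says |ξ| q^N ≤ 1, against |ξ| D > 1 and D ≤ q ≤ q^N. This is
      -- why D enters the threshold for q.
      p≢0 : p ≢ 0ℤ
      p≢0 refl = ev-extract (ev-zip (λ n close 1<∣ξ∣D → <-irrefl refl (<-≤-trans 1<∣ξ∣D (begin
        ∣ seq ξ n ∣ * ⟦ D ⟧         ≡⟨ cong (λ z → ∣ z ∣ * ⟦ D ⟧) (p-0≡p (seq ξ n)) ⟨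
        ∣ seq ξ n - 0ℚ ∣ * ⟦ D ⟧    ≡⟨ cong (λ z → ∣ seq ξ n - z ∣ * ⟦ D ⟧) y≡0 ⟨
        ∣ seq ξ n - y ∣ * ⟦ D ⟧
          ≤⟨ scale-≤ (0≤∣p∣ (seq ξ n - y)) (ℕ.≤-trans (ℕ.≤-trans (ℕ.m≤n⊔m Q₀ D) Q≤q) q≤q^N) close ⟩
        1ℚ                          ∎))) close ξ≢0)
        where
        y≡0 : y ≡ 0ℚ
        y≡0 = ∣p∣≡0⇒p≡0 y (≤-antisym
          (*-cancelʳ-≤-pos ⟦ q ⟧ {{⟦⟧-pos q {{q≢0}}}}
            (≤-reflexive (trans (∣p∣*⟦⟧ y q y*q≡p) (trans ⟦0⟧≡0 (sym (*-zeroˡ ⟦ q ⟧))))))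
          (0≤∣p∣ y))

  ConvergesTo : (ℕ → ℚ) → ℚ → Set
  ConvergesTo f z = ∀ ε → 0ℚ < ε → Eventually (λ n → ∣ f n - z ∣ < ε)

  module _ {c : ℕ → ℕ} (c-digits : ∀ k → IsDigit (c k)) where

    -- With T the denominator t k q^m, the error is at most half of T^(-N). The exponent N is 2 in
    -- the irrationality proof and arbitrary in the final one. The bound K makes both T and the
    -- prime inside `t k` large.
    record ProductApproximation (ξ : ℝ) (m N K : ℕ) : Set where
      field
        k     : ℕ
        K≤k   : K ℕ.≤ k
        p     : ℤ
        q     : ℕ
        q≢0   : ℕ.NonZero q
        p≢0   : p ≢ 0ℤ
        y     : ℚ
        y*q≡p : y * ⟦ q ⟧ ≡ ι p
        close : Eventually (λ n →
          ∣ S c n * pow (seq ξ n) m - S c k * pow y m ∣ * ⟦ 4 ℕ.* (t k ℕ.* q ℕ.^ m) ℕ.^ N ⟧ ≤ ⟦ 2 ⟧)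

      numerator : ℤ
      numerator = + s c k ℤ.* p ℤ.^ m

      denominator : ℕ
      denominator = t k ℕ.* q ℕ.^ m

      instance
        denominator≢0 : ℕ.NonZero denominator
        denominator≢0 = ℕ.m*n≢0 (t k) (q ℕ.^ m) {{t≢0 {k}}} {{ℕ.m^n≢0 q m {{q≢0}}}}

      t≤denominator : t k ℕ.≤ denominator
      t≤denominator = ℕ.m≤m*n (t k) (q ℕ.^ m) {{ℕ.m^n≢0 q m {{q≢0}}}}

      value : ℚ
      value = S c k * pow y m

      value*denominator : value * ⟦ denominator ⟧ ≡ ι numerator
      value*denominator = begin
        S c k * pow y m * ⟦ t k ℕ.* q ℕ.^ m ⟧         ≡⟨ cong (value *_) (⟦⟧-* (t k) (q ℕ.^ m)) ⟩
        S c k * pow y m * (⟦ t k ⟧ * ⟦ q ℕ.^ m ⟧)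
          ≡⟨ *-interchange (S c k) (pow y m) ⟦ t k ⟧ ⟦ q ℕ.^ m ⟧ ⟩
        S c k * ⟦ t k ⟧ * (pow y m * ⟦ q ℕ.^ m ⟧)     ≡⟨ cong₂ _*_ (S-* c k) (pow-fraction {y} m y*q≡p) ⟩
        ⟦ s c k ⟧ * ι (p ℤ.^ m)                       ≡⟨ ι-* (+ s c k) (p ℤ.^ m) ⟨
        ι numerator                                   ∎
        where open ≡-Reasoning

    productApproximation : ∀ {ξ} → Liouville ξ → ∀ m N K → ProductApproximation ξ m N K
    productApproximation {ξ} liouville m N K =
      -- The power q^M absorbs the N-th power of the new denominator, and one more factor q absorbs
      -- the constants: 4 L from the Lipschitz bound, and 12 B from the bound B on y^m, the tail
      -- constant 3 and the factor 4.
      combine (approximation (suc M) (Q ℕ.⊔ (L ℕ.* 4 ℕ.⊔ 3 ℕ.* (B ℕ.* 4))) (s≤s z≤n))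
      where
      A M Q : ℕ
      A = proj₁ (powerApproximation liouville)
      M = proj₁ (separatedScale m N K)
      Q = proj₁ (proj₂ (separatedScale m N K))
      ∣ξ∣≤A : Eventually (λ n → ∣ seq ξ n ∣ ≤ ⟦ A ⟧)
      ∣ξ∣≤A = proj₁ (proj₂ (powerApproximation liouville))
      approximation : ∀ N Q → 1 ℕ.≤ N → PowerApproximation ξ A N Q
      approximation = proj₂ (proj₂ (powerApproximation liouville))
      scale : ∀ q → Q ℕ.≤ q → ∃[ k ] K ℕ.≤ k × (t k ℕ.* q ℕ.^ m) ℕ.^ N ℕ.≤ q ℕ.^ M ×
              q ℕ.* (t k ℕ.* q ℕ.^ m) ℕ.^ N ℕ.< t (suc k)
      scale = proj₂ (proj₂ (separatedScale m N K))
      L B : ℕ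
      L = powLipschitz A m
      B = A ℕ.^ m
      combine : PowerApproximation ξ A (suc M) (Q ℕ.⊔ (L ℕ.* 4 ℕ.⊔ 3 ℕ.* (B ℕ.* 4))) →
        ProductApproximation ξ m N K
      combine approx = atScale (scale q (ℕ.≤-trans (ℕ.m≤m⊔n Q _) Q≤q))
        where
        open PowerApproximation approx
        4L≤q : L ℕ.* 4 ℕ.≤ q
        4L≤q = ℕ.≤-trans (ℕ.≤-trans (ℕ.m≤m⊔n (L ℕ.* 4) _) (ℕ.m≤n⊔m Q _)) Q≤q
        12B≤q : 3 ℕ.* (B ℕ.* 4) ℕ.≤ q
        12B≤q = ℕ.≤-trans (ℕ.≤-trans (ℕ.m≤n⊔m (L ℕ.* 4) _) (ℕ.m≤n⊔m Q _)) Q≤q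
        atScale : ∃[ k ] K ℕ.≤ k × (t k ℕ.* q ℕ.^ m) ℕ.^ N ℕ.≤ q ℕ.^ M ×
                  q ℕ.* (t k ℕ.* q ℕ.^ m) ℕ.^ N ℕ.< t (suc k) → ProductApproximation ξ m N K
        atScale (k , K≤k , W≤q^M , qW<t) = record
          { k = k ; K≤k = K≤k ; p = p ; q = q ; q≢0 = ℕ.>-nonZero (ℕ.≤-trans (s≤s z≤n) 2≤q)
          ; p≢0 = p≢0 ; y = y ; y*q≡p = y*q≡p
          ; close = ev-zip (λ n k≤n h → h k≤n) (k , λ n k≤n → k≤n)
              (ev-zip (λ n ∣ξ∣≤A close k≤n →
                productClose {S c n} {S c k} {seq ξ n} {y} {A} m (4 ℕ.* W) (∣S∣≤1 c-digits n) ∣ξ∣≤A ∣y∣≤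
                  (scale-≤ (0≤∣p∣ (seq ξ n - y)) L4W≤q^[1+M] close)
                  (S-close c-digits k≤n (B ℕ.* (4 ℕ.* W)) 3B4W≤t))
                ∣ξ∣≤A close)
          }
          where
          W : ℕ
          W = (t k ℕ.* q ℕ.^ m) ℕ.^ N
          L4W≤q^[1+M] : L ℕ.* (4 ℕ.* W) ℕ.≤ q ℕ.^ suc M
          L4W≤q^[1+M] = subst (ℕ._≤ q ℕ.^ suc M) (ℕ.*-assoc L 4 W) (ℕ.*-mono-≤ 4L≤q W≤q^M)
          3B4W≤t : 3 ℕ.* (B ℕ.* (4 ℕ.* W)) ℕ.≤ t (suc k)
          3B4W≤t = ℕ.≤-trans (subst (ℕ._≤ q ℕ.* W) (regroup 3 B 4 W) (ℕ.*-monoˡ-≤ W 12B≤q)) (ℕ.<⇒≤ qW<t)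
            where
            regroup : ∀ a b c w → a ℕ.* (b ℕ.* c) ℕ.* w ≡ a ℕ.* (b ℕ.* (c ℕ.* w))
            regroup = ℕ-solve-∀

-- Irrationality of σ ξ^m and its Liouville property

module Products where

  open import Data.Integer.Base as ℤ using (ℤ; +_)
  import Data.Integer.Properties as ℤ
  open import Data.List.Base using (List; []; _∷_)
  open import Data.List.Membership.Propositional using (_∈_; _∉_)
  open import Data.List.Relation.Unary.Any using (here; there)
  open import Data.Nat.Base as ℕ using (ℕ; zero; suc; s≤s; z≤n)
  import Data.Nat.Properties as ℕ
  open import Data.Product.Base using (∃-syntax; _×_; _,_; proj₁; proj₂)
  open import Data.Rational.Base
  open import Data.Rational.Properties
  open import Relation.Binary.PropositionalEquality
  open import Relation.Nullary using (¬_)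
  open import Tactic.RingSolver using (solve-∀)
  open import Axiom.ExcludedMiddle using (ExcludedMiddle)
  open import Level using (0ℓ)
  open import Relation.Nullary.Decidable using (decidable-stable)
  import Defs as R
  open import Defs using (seq; cauchy; Liouville; LiouvilleApproximation; fromℚ; 0ℝ)
  open Arithmetic
  open Rationals
  open Series
  open Approximation

  -- The budget 1 / W is spent in quarters: two on the distance from f n to v, one on the distance
  -- from z to f n, and the last one makes the inequality strict.
  limit-close : ∀ {f z v} W .{{_ : ℕ.NonZero W}} → ConvergesTo f z →
    Eventually (λ n → ∣ f n - v ∣ * ⟦ 4 ℕ.* W ⟧ ≤ ⟦ 2 ⟧) → ∣ z - v ∣ * ⟦ W ⟧ < 1ℚ
  limit-close {f} {z} {v} W f→z f≈v = *-cancelʳ-<-nonNeg ⟦ 4 ⟧ {{⟦⟧-nonNeg 4}}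
    (ev-extract (ev-zip combine (f→z (+ 1 / (4 ℕ.* W)) 0<ε) f≈v))
    where
    open ≤-Reasoning
    instance
      4W≢0 : ℕ.NonZero (4 ℕ.* W)
      4W≢0 = ℕ.m*n≢0 4 W
    ε*4W≡1 : + 1 / (4 ℕ.* W) * ⟦ 4 ℕ.* W ⟧ ≡ ⟦ 1 ⟧
    ε*4W≡1 = /-*-cancel (+ 1) (4 ℕ.* W)
    0<ε : 0ℚ < + 1 / (4 ℕ.* W)
    0<ε = reciprocal>0 (4 ℕ.* W) ε*4W≡1
    regroup : ∀ x a w → x * w * a ≡ x * (a * w)
    regroup = solve-∀ ℚ-ring
    combine : ∀ n → ∣ f n - z ∣ < + 1 / (4 ℕ.* W) → ∣ f n - v ∣ * ⟦ 4 ℕ.* W ⟧ ≤ ⟦ 2 ⟧ →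
      ∣ z - v ∣ * ⟦ W ⟧ * ⟦ 4 ⟧ < 1ℚ * ⟦ 4 ⟧
    combine n fn≈z fn≈v = begin-strict
      ∣ z - v ∣ * ⟦ W ⟧ * ⟦ 4 ⟧
        ≡⟨ trans (regroup ∣ z - v ∣ ⟦ 4 ⟧ ⟦ W ⟧) (cong (∣ z - v ∣ *_) (sym (⟦⟧-* 4 W))) ⟩
      ∣ z - v ∣ * ⟦ 4 ℕ.* W ⟧
        ≤⟨ 0≤⇒*-monoʳ-≤ ⟦ 4 ℕ.* W ⟧ (0≤⟦⟧ (4 ℕ.* W)) (∣p-r∣≤∣p-q∣+∣q-r∣ z (f n) v) ⟩
      (∣ z - f n ∣ + ∣ f n - v ∣) * ⟦ 4 ℕ.* W ⟧
        ≡⟨ *-distribʳ-+ ⟦ 4 ℕ.* W ⟧ ∣ z - f n ∣ ∣ f n - v ∣ ⟩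
      ∣ z - f n ∣ * ⟦ 4 ℕ.* W ⟧ + ∣ f n - v ∣ * ⟦ 4 ℕ.* W ⟧
        ≤⟨ +-mono-≤ (0≤⇒*-monoʳ-≤ ⟦ 4 ℕ.* W ⟧ (0≤⟦⟧ (4 ℕ.* W))
             (<⇒≤ (subst (_< + 1 / (4 ℕ.* W)) (∣p-q∣≡∣q-p∣ (f n) z) fn≈z))) fn≈v ⟩
      + 1 / (4 ℕ.* W) * ⟦ 4 ℕ.* W ⟧ + ⟦ 2 ⟧   ≡⟨ cong (_+ ⟦ 2 ⟧) ε*4W≡1 ⟩
      ⟦ 1 ⟧ + ⟦ 2 ⟧   ≡⟨ ⟦⟧-+ 1 2 ⟨
      ⟦ 3 ⟧           <⟨ ⟦⟧-mono-< ℕ.≤-refl ⟩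
      ⟦ 4 ⟧           ≡⟨ *-identityˡ ⟦ 4 ⟧ ⟨
      1ℚ * ⟦ 4 ⟧      ∎

  ∣i^n∣≡∣i∣^n : ∀ i n → ℤ.∣ i ℤ.^ n ∣ ≡ ℤ.∣ i ∣ ℕ.^ n
  ∣i^n∣≡∣i∣^n i zero    = refl
  ∣i^n∣≡∣i∣^n i (suc n) = trans (ℤ.abs-* i (i ℤ.^ n)) (cong (ℤ.∣ i ∣ ℕ.*_) (∣i^n∣≡∣i∣^n i n))

  -- For a Cauchy sequence a single late term of size at least ε keeps all late terms above ε / 2,
  -- which is already apartness from 0. The comparison is between rationals, so no excluded middle
  -- is needed here.
  ¬apart⇒null : ∀ y → ¬ R._<_ 0ℝ R.∣ y ∣ → ConvergesTo (seq y) 0ℚ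
  ¬apart⇒null y y≮ ε 0<ε = N , λ n N≤n → ≰⇒> λ ε≤ → y≮ (½ * ε , 0<½ε , N , λ m N≤m →
    subst (_< ∣ seq y m ∣) (sym (+-identityˡ (½ * ε)))
      (+-cancelˡ-< (½ * ε) (begin-strict
        ½ * ε + ½ * ε                    ≡⟨ trans (sym (*-distribʳ-+ ε ½ ½)) (*-identityˡ ε) ⟩
        ε                                ≤⟨ ε≤ ⟩
        ∣ seq y n - 0ℚ ∣                 ≡⟨ cong ∣_∣ (p-0≡p (seq y n)) ⟩
        ∣ seq y n ∣                      ≤⟨ ∣p∣≤∣p-q∣+∣q∣ (seq y n) (seq y m) ⟩
        ∣ seq y n - seq y m ∣ + ∣ seq y m ∣ <⟨ +-monoˡ-< ∣ seq y m ∣ (close n m N≤n N≤m) ⟩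
        ½ * ε + ∣ seq y m ∣              ∎)))
    where
    open ≤-Reasoning
    0<½ε : 0ℚ < ½ * ε
    0<½ε = positive⁻¹ _ {{pos*pos⇒pos ½ ε {{positive 0<ε}}}}
    N : ℕ
    N = proj₁ (cauchy y (½ * ε) 0<½ε)
    close : ∀ m n → N ℕ.≤ m → N ℕ.≤ n → ∣ seq y m - seq y n ∣ < ½ * ε
    close = proj₂ (cauchy y (½ * ε) 0<½ε)

  ¬convergesTo⇒apart : ExcludedMiddle 0ℓ → ∀ x z → ¬ ConvergesTo (seq x) z →
    R._<_ 0ℝ R.∣ x R.- fromℚ z ∣
  ¬convergesTo⇒apart em x z x↛z = decidable-stable em λ ¬apart → x↛z λ ε 0<ε →
    ev-map (λ n → subst (_< ε) (cong ∣_∣ (p-0≡p (seq x n - z))))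
      (¬apart⇒null (x R.- fromℚ z) ¬apart ε 0<ε)

  -- Two quarters of 1 / W pay for the error, the third is the witness `w` for the strict order of
  -- the reals, and the fourth gives strictness at each index.
  quarterGap : ∀ {x u v w} W .{{_ : ℕ.NonZero W}} → u * ⟦ W ⟧ ≡ ⟦ 1 ⟧ → w * ⟦ 4 ℕ.* W ⟧ ≡ ⟦ 1 ⟧ →
    ∣ x - v ∣ * ⟦ 4 ℕ.* W ⟧ ≤ ⟦ 2 ⟧ → ∣ x - v ∣ + w < u
  quarterGap {x} {u} {v} {w} W u*W≡1 w*4W≡1 x≈v =
    *-cancelʳ-<-nonNeg ⟦ 4 ℕ.* W ⟧ {{⟦⟧-nonNeg (4 ℕ.* W)}} (begin-strict
      (∣ x - v ∣ + w) * ⟦ 4 ℕ.* W ⟧                   ≡⟨ *-distribʳ-+ ⟦ 4 ℕ.* W ⟧ ∣ x - v ∣ w ⟩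
      ∣ x - v ∣ * ⟦ 4 ℕ.* W ⟧ + w * ⟦ 4 ℕ.* W ⟧       ≤⟨ +-mono-≤ x≈v (≤-reflexive w*4W≡1) ⟩
      ⟦ 2 ⟧ + ⟦ 1 ⟧                                   ≡⟨ ⟦⟧-+ 2 1 ⟨
      ⟦ 3 ⟧                                           <⟨ ⟦⟧-mono-< ℕ.≤-refl ⟩
      ⟦ 4 ⟧                                           ≡⟨ *-identityʳ ⟦ 4 ⟧ ⟨
      ⟦ 4 ⟧ * 1ℚ                                      ≡⟨ cong (⟦ 4 ⟧ *_) (trans u*W≡1 ⟦1⟧≡1) ⟨
      ⟦ 4 ⟧ * (u * ⟦ W ⟧)                             ≡⟨ regroup ⟦ 4 ⟧ u ⟦ W ⟧ ⟩
      u * (⟦ 4 ⟧ * ⟦ W ⟧)                             ≡⟨ cong (u *_) (⟦⟧-* 4 W) ⟨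
      u * ⟦ 4 ℕ.* W ⟧                                 ∎)
    where
    open ≤-Reasoning
    regroup : ∀ a u w → a * (u * w) ≡ u * (a * w)
    regroup = solve-∀ ℚ-ring

  close⇒< : ∀ x u v W .{{_ : ℕ.NonZero W}} → u * ⟦ W ⟧ ≡ ⟦ 1 ⟧ →
    Eventually (λ n → ∣ seq x n - v ∣ * ⟦ 4 ℕ.* W ⟧ ≤ ⟦ 2 ⟧) → R._<_ R.∣ x R.- fromℚ v ∣ (fromℚ u)
  close⇒< x u v W u*W≡1 x≈v = gap (+ 1 / (4 ℕ.* W)) (/-*-cancel (+ 1) (4 ℕ.* W))
    where
    instance
      4W≢0 : ℕ.NonZero (4 ℕ.* W)
      4W≢0 = ℕ.m*n≢0 4 W
    gap : ∀ w → w * ⟦ 4 ℕ.* W ⟧ ≡ ⟦ 1 ⟧ → R._<_ R.∣ x R.- fromℚ v ∣ (fromℚ u)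
    gap w w*4W≡1 = w , reciprocal>0 (4 ℕ.* W) w*4W≡1
      , ev-map (λ n → quarterGap {seq x n} {u} {v} {w} W u*W≡1 w*4W≡1) x≈v

  liouvilleApproximation : ExcludedMiddle 0ℓ → ∀ x N {P v} T → 2 ℕ.≤ T →
    (∀ z → z * ⟦ T ⟧ ≡ ι P → ¬ ConvergesTo (seq x) z) → v * ⟦ T ⟧ ≡ ι P →
    Eventually (λ n → ∣ seq x n - v ∣ * ⟦ 4 ℕ.* T ℕ.^ N ⟧ ≤ ⟦ 2 ⟧) → LiouvilleApproximation x N (P , T)
  liouvilleApproximation em x N {P} {v} T 2≤T irrational v*T≡P x≈v = record
    { q≥2     = 2≤T
    ; nonzero = ¬convergesTo⇒apart em x (P / T) (irrational (P / T) (/-*-cancel P T))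
    ; close   = subst (λ z → R._<_ R.∣ x R.- fromℚ z ∣ (fromℚ ((+ 1 / (T ℕ.^ N)) {{T^N≢0}})))
        (*-cancelʳ-⟦⟧ T (trans v*T≡P (sym (/-*-cancel P T))))
        (close⇒< x ((+ 1 / (T ℕ.^ N)) {{T^N≢0}}) v (T ℕ.^ N) {{T^N≢0}}
          (/-*-cancel (+ 1) (T ℕ.^ N) {{T^N≢0}}) x≈v)
    }
    where
    instance
      T≢0 : ℕ.NonZero T
      T≢0 = ℕ.>-nonZero (ℕ.<-trans ℕ.0<1+n 2≤T)
    T^N≢0 : ℕ.NonZero (T ℕ.^ N)
    T^N≢0 = ℕ.m^n≢0 T N

  module _ {c : ℕ → ℕ} (c-digits : ∀ k → IsDigit (c k)) where

    -- An approximant with denominator T ≥ Q and error below T^(-2) is closer to P / Q than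
    -- `fractionGap` permits for different fractions, and equality is excluded by
    -- `s/t-notPowerRatio`.
    product-irrational : ∀ {ξ} → Liouville ξ → ∀ m {z P} Q .{{_ : ℕ.NonZero Q}} → z * ⟦ Q ⟧ ≡ ι P →
      ¬ ConvergesTo (λ n → S c n * pow (seq ξ n) (2 ℕ.+ m)) z
    product-irrational {ξ} liouville m {z} {P} Q z*Q≡P f→z =
      -- The successor makes the scale at least 1, so it has the form `suc k`: its denominator
      -- `t (suc k)` contains the prime `l k`, and l k > k bounds both |P| and Q.
      contradict (productApproximation c-digits liouville (2 ℕ.+ m) 2 (suc (ℤ.∣ P ∣ ℕ.⊔ Q)))
      where
      contradict : ¬ ProductApproximation c-digits ξ (2 ℕ.+ m) 2 (suc (ℤ.∣ P ∣ ℕ.⊔ Q))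
      contradict approx@record { k = suc k ; K≤k = s≤s PQ≤k } = <-irrefl refl 1<1
        where
        open ProductApproximation approx
          using (p; q; p≢0; value; value*denominator; close; numerator; t≤denominator; denominator≢0)
          renaming (denominator to T)
        Q≤k : Q ℕ.≤ k
        Q≤k = ℕ.≤-trans (ℕ.m≤n⊔m ℤ.∣ P ∣ Q) PQ≤k
        Q≤T : Q ℕ.≤ T
        Q≤T = ℕ.≤-trans (ℕ.≤-trans Q≤k (ℕ.≤-trans (ℕ.n≤1+n k) (ℕ.<⇒≤ (k<t (suc k))))) t≤denominator
        QT≤T² : Q ℕ.* T ℕ.≤ T ℕ.^ 2
        QT≤T² = ℕ.≤-trans (ℕ.*-monoˡ-≤ T Q≤T) (ℕ.≤-reflexive (cong (T ℕ.*_) (sym (ℕ.*-identityʳ T))))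
        differ : P ℤ.* + T ≢ numerator ℤ.* + Q
        differ eq = s/t-notPowerRatio c-digits k m ℤ.∣ p ∣ q (ℕ.≤-trans (ℕ.m≤m⊔n ℤ.∣ P ∣ Q) PQ≤k) Q≤k
          (λ ∣p∣≡0 → p≢0 (ℤ.∣i∣≡0⇒i≡0 ∣p∣≡0)) (begin
            ℤ.∣ P ∣ ℕ.* t (suc k) ℕ.* q ℕ.^ (2 ℕ.+ m)
              ≡⟨ ℕ.*-assoc ℤ.∣ P ∣ (t (suc k)) (q ℕ.^ (2 ℕ.+ m)) ⟩
            ℤ.∣ P ∣ ℕ.* T                               ≡⟨ ℤ.abs-* P (+ T) ⟨
            ℤ.∣ P ℤ.* + T ∣                             ≡⟨ cong ℤ.∣_∣ eq ⟩
            ℤ.∣ numerator ℤ.* + Q ∣                     ≡⟨ ℤ.abs-* numerator (+ Q) ⟩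
            ℤ.∣ numerator ∣ ℕ.* Q
              ≡⟨ cong (ℕ._* Q) (ℤ.abs-* (+ s c (suc k)) (p ℤ.^ (2 ℕ.+ m))) ⟩
            s c (suc k) ℕ.* ℤ.∣ p ℤ.^ (2 ℕ.+ m) ∣ ℕ.* Q
              ≡⟨ ℕ.*-comm (s c (suc k) ℕ.* ℤ.∣ p ℤ.^ (2 ℕ.+ m) ∣) Q ⟩
            Q ℕ.* (s c (suc k) ℕ.* ℤ.∣ p ℤ.^ (2 ℕ.+ m) ∣)
              ≡⟨ ℕ.*-assoc Q (s c (suc k)) ℤ.∣ p ℤ.^ (2 ℕ.+ m) ∣ ⟨
            Q ℕ.* s c (suc k) ℕ.* ℤ.∣ p ℤ.^ (2 ℕ.+ m) ∣
              ≡⟨ cong (Q ℕ.* s c (suc k) ℕ.*_) (∣i^n∣≡∣i∣^n p (2 ℕ.+ m)) ⟩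
            Q ℕ.* s c (suc k) ℕ.* ℤ.∣ p ∣ ℕ.^ (2 ℕ.+ m) ∎)
          where open ≡-Reasoning
        1<1 : 1ℚ < 1ℚ
        1<1 = begin-strict
          1ℚ
            ≤⟨ fractionGap {z} {value} {P} {numerator} Q T z*Q≡P value*denominator differ ⟩
          ∣ z - value ∣ * ⟦ Q ℕ.* T ⟧
            ≤⟨ 0≤⇒*-monoˡ-≤ ∣ z - value ∣ (0≤∣p∣ (z - value)) (⟦⟧-mono-≤ QT≤T²) ⟩
          ∣ z - value ∣ * ⟦ T ℕ.^ 2 ⟧
            <⟨ limit-close {λ n → S c n * pow (seq ξ n) (2 ℕ.+ m)} {z} {value}
              (T ℕ.^ 2) {{ℕ.m^n≢0 T 2}} f→z close ⟩
          1ℚ                            ∎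
          where open ≤-Reasoning

    -- Being a Liouville number depends only on the sequence of x, so x is arbitrary and the Cauchy
    -- proof of `σ * ξ ^ m` stays out of the argument.
    product-liouville : ExcludedMiddle 0ℓ → ∀ {ξ} → Liouville ξ → ∀ m → 2 ℕ.≤ m → ∀ x →
      (∀ n → seq x n ≡ S c n * pow (seq ξ n) m) → Liouville x
    product-liouville em {ξ} liouville (suc (suc m)) (s≤s (s≤s z≤n)) x seq-x N 1≤N as =
      -- The new denominator is at least t k > k, hence exceeds every denominator in the given list.
      conclude (productApproximation c-digits liouville (2 ℕ.+ m) N (bound as))
      where
      bound : List (ℤ × ℕ) → ℕ
      bound []             = 0
      bound ((_ , q) ∷ as) = q ℕ.⊔ bound as
      ∈⇒≤bound : ∀ {p q} as → (p , q) ∈ as → q ℕ.≤ bound as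
      ∈⇒≤bound ((_ , q) ∷ as) (here refl) = ℕ.m≤m⊔n q (bound as)
      ∈⇒≤bound ((_ , q) ∷ as) (there pq∈) = ℕ.≤-trans (∈⇒≤bound as pq∈) (ℕ.m≤n⊔m q (bound as))
      conclude : ProductApproximation c-digits ξ (2 ℕ.+ m) N (bound as) →
        ∃[ pq ] pq ∉ as × LiouvilleApproximation x N pq
      conclude approx = (numerator , denominator) , T∉as
        , liouvilleApproximation em x N {numerator} {value} denominator
            2≤T x-irrational value*denominator x≈value
        where
        open ProductApproximation approx
        T∉as : (numerator , denominator) ∉ as
        T∉as T∈as = ℕ.<⇒≱ (ℕ.≤-<-trans K≤k (ℕ.<-≤-trans (k<t k) t≤denominator)) (∈⇒≤bound as T∈as)
        2≤T : 2 ℕ.≤ denominator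
        2≤T = ℕ.≤-trans (ℕ.≤-trans (s≤s (s≤s z≤n)) (t≥8 k)) t≤denominator
        x-irrational : ∀ z → z * ⟦ denominator ⟧ ≡ ι numerator → ¬ ConvergesTo (seq x) z
        x-irrational z z*T≡P x→z = product-irrational liouville m denominator z*T≡P
          (λ ε 0<ε → ev-map (λ n → subst (λ u → ∣ u - z ∣ < ε) (seq-x n)) (x→z ε 0<ε))
        x≈value : Eventually (λ n → ∣ seq x n - value ∣ * ⟦ 4 ℕ.* denominator ℕ.^ N ⟧ ≤ ⟦ 2 ⟧)
        x≈value = ev-map (λ n →
          subst (λ u → ∣ u - value ∣ * ⟦ 4 ℕ.* denominator ℕ.^ N ⟧ ≤ ⟦ 2 ⟧) (sym (seq-x n))) close

    seq-σξ^m : ∀ ξ m n → seq (σ {c} c-digits R.* ξ R.^ m) n ≡ S c n * pow (seq ξ n) m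
    seq-σξ^m ξ m n = trans (seq-* (σ c-digits) (ξ R.^ m) n)
      (cong₂ _*_ (seq-σ c-digits n) (seq-^ m n))
      where
      seq-* : ∀ x y n → seq (x R.* y) n ≡ seq x n * seq y n
      seq-* x y n = refl
      seq-^ : ∀ m n → seq (ξ R.^ m) n ≡ pow (seq ξ n) m
      seq-^ zero    n = refl
      seq-^ (suc m) n = trans (seq-* ξ (ξ R.^ m) n) (cong (λ u → seq ξ n * u) (seq-^ m n))

    σξ^m-liouville : ExcludedMiddle 0ℓ → ∀ m → 2 ℕ.≤ m → ∀ ξ → Liouville ξ →
      Liouville (σ {c} c-digits R.* ξ R.^ m)
    σξ^m-liouville em m 2≤m ξ liouville =
      product-liouville em liouville m 2≤m (σ {c} c-digits R.* ξ R.^ m) (seq-σξ^m ξ m)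

-- Transcendence of σ

module Transcendence where

  open import Data.Integer.Base as ℤ using (ℤ; 0ℤ; +_)
  import Data.Integer.Divisibility.Signed as ℤ
  import Data.Integer.Properties as ℤ
  import Data.Integer.Tactic.RingSolver as ℤ
  open import Data.List.Base using (List; []; _∷_; length)
  open import Data.List.Relation.Unary.All using (All; []; _∷_; lookupAny)
  open import Data.List.Relation.Unary.Any using (Any)
  open import Data.Nat.Base as ℕ using (ℕ; zero; suc; s≤s; z≤n)
  open import Data.Nat.Divisibility using (_∣_; _∤_; _∣0)
  open import Data.Nat.Primality using (Prime; euclidsLemma)
  import Data.Nat.Properties as ℕ
  import Data.Nat.Tactic.RingSolver as ℕ
  open import Data.Product.Base using (∃-syntax; _×_; _,_)
  open import Data.Rational.Base
  open import Data.Rational.Properties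
  open import Data.Sum.Base using (_⊎_; inj₁; inj₂; [_,_]′)
  open import Relation.Binary.PropositionalEquality
  open import Relation.Nullary using (yes; no)
  open import Tactic.RingSolver using (solve-∀)
  open import Defs using (seq; evalPoly; Transcendental)
  open Arithmetic
  open Rationals
  open Series
  open Approximation
  open Products

  poly : List ℤ → ℚ → ℚ
  poly []       x = 0ℚ
  poly (a ∷ as) x = ι a + x * poly as x

  seq-evalPoly : ∀ as x n → seq (evalPoly as x) n ≡ poly as (seq x n)
  seq-evalPoly []       x n = refl
  seq-evalPoly (a ∷ as) x n =
    cong₂ (λ u v → u + seq x n * v) (sym (ι-def a)) (seq-evalPoly as x n)

  height : List ℤ → ℕ
  height []       = 0
  height (a ∷ as) = ℤ.∣ a ∣ ℕ.+ height as

  ∣poly∣≤ : ∀ as {x} → ∣ x ∣ ≤ 1ℚ → ∣ poly as x ∣ ≤ ⟦ height as ⟧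
  ∣poly∣≤ []       {x} ∣x∣≤1 = ≤-reflexive (sym ⟦0⟧≡0)
  ∣poly∣≤ (a ∷ as) {x} ∣x∣≤1 = begin
    ∣ ι a + x * poly as x ∣             ≤⟨ ∣p+q∣≤∣p∣+∣q∣ (ι a) (x * poly as x) ⟩
    ∣ ι a ∣ + ∣ x * poly as x ∣         ≡⟨ cong₂ _+_ (∣ι∣ a) (∣p*q∣≡∣p∣*∣q∣ x (poly as x)) ⟩
    ⟦ ℤ.∣ a ∣ ⟧ + ∣ x ∣ * ∣ poly as x ∣
      ≤⟨ +-monoʳ-≤ ⟦ ℤ.∣ a ∣ ⟧ (*-mono-≤ (0≤∣p∣ x) (0≤⟦⟧ (height as)) ∣x∣≤1 (∣poly∣≤ as ∣x∣≤1)) ⟩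
    ⟦ ℤ.∣ a ∣ ⟧ + 1ℚ * ⟦ height as ⟧    ≡⟨ cong (λ u → ⟦ ℤ.∣ a ∣ ⟧ + u) (*-identityˡ ⟦ height as ⟧) ⟩
    ⟦ ℤ.∣ a ∣ ⟧ + ⟦ height as ⟧         ≡⟨ ⟦⟧-+ ℤ.∣ a ∣ (height as) ⟨
    ⟦ ℤ.∣ a ∣ ℕ.+ height as ⟧           ∎
    where open ≤-Reasoning

  -- The sum of i |a_i|, which bounds the derivative on [-1, 1].
  polyLipschitz : List ℤ → ℕ
  polyLipschitz []       = 0
  polyLipschitz (a ∷ as) = polyLipschitz as ℕ.+ height as

  ∣poly-poly∣≤ : ∀ as {x y} → ∣ x ∣ ≤ 1ℚ → ∣ y ∣ ≤ 1ℚ →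
    ∣ poly as x - poly as y ∣ ≤ ⟦ polyLipschitz as ⟧ * ∣ x - y ∣
  ∣poly-poly∣≤ []       {x} {y} ∣x∣≤1 ∣y∣≤1 = ≤-reflexive (sym
    (trans (cong (_* ∣ x - y ∣) ⟦0⟧≡0) (*-zeroˡ ∣ x - y ∣)))
  ∣poly-poly∣≤ (a ∷ as) {x} {y} ∣x∣≤1 ∣y∣≤1 = begin
    ∣ (ι a + x * poly as x) - (ι a + y * poly as y) ∣
      ≡⟨ cong ∣_∣ (cancel (ι a) (x * poly as x) (y * poly as y)) ⟩
    ∣ x * poly as x - y * poly as y ∣
      ≤⟨ ∣*-*∣≤ x (poly as x) y (poly as y) ⟩
    ∣ x ∣ * ∣ poly as x - poly as y ∣ + ∣ x - y ∣ * ∣ poly as y ∣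
      ≤⟨ +-mono-≤
        (*-mono-≤ (0≤∣p∣ x) (0≤* (0≤⟦⟧ L) (0≤∣p∣ (x - y))) ∣x∣≤1 (∣poly-poly∣≤ as ∣x∣≤1 ∣y∣≤1))
        (0≤⇒*-monoˡ-≤ ∣ x - y ∣ (0≤∣p∣ (x - y)) (∣poly∣≤ as ∣y∣≤1)) ⟩
    1ℚ * (⟦ L ⟧ * ∣ x - y ∣) + ∣ x - y ∣ * ⟦ height as ⟧
      ≡⟨ regroup ⟦ L ⟧ ∣ x - y ∣ ⟦ height as ⟧ ⟩
    (⟦ L ⟧ + ⟦ height as ⟧) * ∣ x - y ∣
      ≡⟨ cong (_* ∣ x - y ∣) (⟦⟧-+ L (height as)) ⟨
    ⟦ L ℕ.+ height as ⟧ * ∣ x - y ∣ ∎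
    where
    open ≤-Reasoning
    L : ℕ
    L = polyLipschitz as
    cancel : ∀ a b c → (a + b) - (a + c) ≡ b - c
    cancel = solve-∀ ℚ-ring
    regroup : ∀ l d h → 1ℚ * (l * d) + d * h ≡ (l + h) * d
    regroup = solve-∀ ℚ-ring

  -- The value at s / T times T^(length), one power above the formal degree. Thus every term, even
  -- the last one, keeps a factor T, and the empty list is no exception.
  homogenise : List ℤ → ℤ → ℤ → ℤ
  homogenise []       s T = 0ℤ
  homogenise (a ∷ as) s T = a ℤ.* T ℤ.^ suc (length as) ℤ.+ s ℤ.* homogenise as s T

  poly-homogenise : ∀ as {y s T} → y * ι T ≡ ι s →
    poly as y * ι (T ℤ.^ length as) ≡ ι (homogenise as s T)
  poly-homogenise []       {y} {s} {T} y*T≡s = trans (*-zeroˡ (ι (+ 1))) (sym ⟦0⟧≡0)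
  poly-homogenise (a ∷ as) {y} {s} {T} y*T≡s = begin
    (ι a + y * poly as y) * ι (T ℤ.* T ℤ.^ d)
      ≡⟨ cong ((ι a + y * poly as y) *_) (ι-* T (T ℤ.^ d)) ⟩
    (ι a + y * poly as y) * (ι T * ι (T ℤ.^ d))
      ≡⟨ regroup (ι a) y (poly as y) (ι T) (ι (T ℤ.^ d)) ⟩
    ι a * (ι T * ι (T ℤ.^ d)) + (y * ι T) * (poly as y * ι (T ℤ.^ d))
      ≡⟨ cong₂ (λ u v → ι a * u + v) (sym (ι-* T (T ℤ.^ d))) (cong₂ _*_ y*T≡s (poly-homogenise as y*T≡s)) ⟩
    ι a * ι (T ℤ.^ suc d) + ι s * ι (homogenise as s T)
      ≡⟨ cong₂ _+_ (ι-* a (T ℤ.^ suc d)) (ι-* s (homogenise as s T)) ⟨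
    ι (a ℤ.* T ℤ.^ suc d) + ι (s ℤ.* homogenise as s T)
      ≡⟨ ι-+ (a ℤ.* T ℤ.^ suc d) (s ℤ.* homogenise as s T) ⟨
    ι (homogenise (a ∷ as) s T) ∎
    where
    open ≡-Reasoning
    d : ℕ
    d = length as
    regroup : ∀ a y p t u → (a + y * p) * (t * u) ≡ a * (t * u) + (y * t) * (p * u)
    regroup = solve-∀ ℚ-ring

  module _ {l s T} (l-prime : Prime l) (l∣T : l ∣ ℤ.∣ T ∣) (l∤s : l ∤ ℤ.∣ s ∣) where

    -- Modulo l, the factor b is the leading coefficient times a power of s.
    homogenise-shape : ∀ as → height as ℕ.< l →
      (All (_≡ 0ℤ) as × homogenise as s T ≡ 0ℤ) ⊎
      (∃[ e ] ∃[ j ] ∃[ b ] e ℕ.+ j ≡ length as × homogenise as s T ≡ b ℤ.* T ℤ.^ e × l ∤ ℤ.∣ b ∣)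
    homogenise-shape []       _        = inj₁ ([] , refl)
    homogenise-shape (a ∷ as) height<l
      with homogenise-shape as (ℕ.≤-<-trans (ℕ.m≤n+m (height as) ℤ.∣ a ∣) height<l)
    ... | inj₂ (e , j , b , e+j≡d , H≡bTᵉ , l∤b) = inj₂
      (e , suc j , a ℤ.* T ℤ.^ suc j ℤ.+ s ℤ.* b , trans (ℕ.+-suc e j) (cong suc e+j≡d) , eq , l∤)
      where
      open ≡-Reasoning
      regroup : ∀ a s b u v w → a ℤ.* (u ℤ.* (v ℤ.* w)) ℤ.+ s ℤ.* (b ℤ.* v) ≡ (a ℤ.* (u ℤ.* w) ℤ.+ s ℤ.* b) ℤ.* v
      regroup = ℤ.solve-∀
      eq : homogenise (a ∷ as) s T ≡ (a ℤ.* T ℤ.^ suc j ℤ.+ s ℤ.* b) ℤ.* T ℤ.^ e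
      eq = begin
        a ℤ.* T ℤ.^ suc (length as) ℤ.+ s ℤ.* homogenise as s T
          ≡⟨ cong₂ (λ d h → a ℤ.* T ℤ.^ suc d ℤ.+ s ℤ.* h) (sym e+j≡d) H≡bTᵉ ⟩
        a ℤ.* (T ℤ.* T ℤ.^ (e ℕ.+ j)) ℤ.+ s ℤ.* (b ℤ.* T ℤ.^ e)
          ≡⟨ cong (λ u → a ℤ.* (T ℤ.* u) ℤ.+ s ℤ.* (b ℤ.* T ℤ.^ e)) (ℤ.^-distribˡ-+-* T e j) ⟩
        a ℤ.* (T ℤ.* (T ℤ.^ e ℤ.* T ℤ.^ j)) ℤ.+ s ℤ.* (b ℤ.* T ℤ.^ e)
          ≡⟨ regroup a s b T (T ℤ.^ e) (T ℤ.^ j) ⟩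
        (a ℤ.* T ℤ.^ suc j ℤ.+ s ℤ.* b) ℤ.* T ℤ.^ e ∎
      -- The new summand `a ℤ.* T ℤ.^ suc j` vanishes modulo l, so modulo l the old factor is merely
      -- multiplied by s.
      l∤ : l ∤ ℤ.∣ a ℤ.* T ℤ.^ suc j ℤ.+ s ℤ.* b ∣
      l∤ l∣sum = [ l∤s , l∤b ]′ (euclidsLemma ℤ.∣ s ∣ ℤ.∣ b ∣ l-prime
        (subst (l ∣_) (ℤ.abs-* s b) (ℤ.∣⇒∣ᵤ {+ l} (ℤ.∣m+n∣m⇒∣n
          (ℤ.∣ᵤ⇒∣ {+ l} {a ℤ.* T ℤ.^ suc j ℤ.+ s ℤ.* b} l∣sum)
          (ℤ.∣n⇒∣m*n a (ℤ.∣m⇒∣m*n (T ℤ.^ j) (ℤ.∣ᵤ⇒∣ {+ l} {T} l∣T)))))))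
    ... | inj₁ (as≡0 , H≡0) with a ℤ.≟ 0ℤ
    ... | yes refl = inj₁ (refl ∷ as≡0 , trans (ℤ.+-identityˡ (s ℤ.* homogenise as s T))
      (trans (cong (s ℤ.*_) H≡0) (ℤ.*-zeroʳ s)))
    -- This entry is the leading coefficient. It is nonzero and at most the height, hence smaller
    -- than l; the powers of T due to the zero entries after it go into the exponent.
    ... | no  a≢0  = inj₂ (suc (length as) , 0 , a , ℕ.+-identityʳ (suc (length as))
      , trans (cong (λ u → a ℤ.* T ℤ.^ suc (length as) ℤ.+ u) (trans (cong (s ℤ.*_) H≡0) (ℤ.*-zeroʳ s)))
          (ℤ.+-identityʳ (a ℤ.* T ℤ.^ suc (length as)))
      , λ l∣a → ℕ.<⇒≱ (ℕ.≤-<-trans (ℕ.m≤m+n ℤ.∣ a ∣ (height as)) height<l)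
          (∣⇒≤′ {{ℕ.≢-nonZero (λ ∣a∣≡0 → a≢0 (ℤ.∣i∣≡0⇒i≡0 ∣a∣≡0))}} l∣a))
      where open import Data.Nat.Divisibility using () renaming (∣⇒≤ to ∣⇒≤′)

    homogenise≢0 : ∀ as → .{{ℤ.NonZero T}} → height as ℕ.< l → Any (_≢ 0ℤ) as → homogenise as s T ≢ 0ℤ
    homogenise≢0 as height<l as≢0 H≡0 with homogenise-shape as height<l
    ... | inj₁ (as≡0 , _) = let (a≡0 , a≢0) = lookupAny as≡0 as≢0 in a≢0 a≡0
    ... | inj₂ (e , j , b , _ , H≡bTᵉ , l∤b) =
      [ (λ b≡0 → l∤b (subst (λ u → l ∣ ℤ.∣ u ∣) (sym b≡0) (l ∣0)))
      , (λ Tᵉ≡0 → ℕ.≢-nonZero⁻¹ (ℤ.∣ T ∣ ℕ.^ e) {{ℕ.m^n≢0 ℤ.∣ T ∣ e}}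
          (trans (sym (∣i^n∣≡∣i∣^n T e)) (cong ℤ.∣_∣ Tᵉ≡0)))
      ]′ (ℤ.i*j≡0⇒i≡0∨j≡0 b (trans (sym H≡bTᵉ) H≡0))

  pos-^ : ∀ m n → (+ m) ℤ.^ n ≡ + (m ℕ.^ n)
  pos-^ m zero    = refl
  pos-^ m (suc n) = trans (cong (+ m ℤ.*_) (pos-^ m n)) (sym (ℤ.pos-* m (m ℕ.^ n)))

  module _ {c : ℕ → ℕ} (c-digits : ∀ k → IsDigit (c k)) where

    -- Liouville's argument: the value at s / T is a nonzero integer over W = T^d, hence at least 1
    -- / W in size; but s / T is so close to σ that the value differs from 0 by less than 1 / W.
    σ-transcendental : Transcendental (σ {c} c-digits)
    σ-transcendental (as , as≢0 , evalPoly≈0) = <-irrefl refl (begin-strict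
      1ℚ                           ≡⟨ ⟦1⟧≡1 ⟨
      ⟦ 1 ⟧                        ≤⟨ ⟦⟧-mono-≤ (ℕ.n≢0⇒n>0 λ ∣H∣≡0 → H≢0 (ℤ.∣i∣≡0⇒i≡0 ∣H∣≡0)) ⟩
      ⟦ ℤ.∣ H ∣ ⟧
        ≡⟨ ∣p∣*⟦⟧ (poly as y) W (subst (λ u → poly as y * u ≡ ι H)
             (cong ι (pos-^ T d))
             (poly-homogenise as {y} {+ s c (suc k)} {+ T} (S-* c (suc k)))) ⟨
      ∣ poly as y ∣ * ⟦ W ⟧        ≡⟨ cong (_* ⟦ W ⟧) (∣p∣≡∣0-p∣ (poly as y)) ⟩
      ∣ 0ℚ - poly as y ∣ * ⟦ W ⟧
        <⟨ limit-close {λ n → poly as (S c n)} {0ℚ} {poly as y} W {{W≢0}} P→0 P≈ ⟩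
      1ℚ                           ∎)
      where
      open ≤-Reasoning
      d L k T W : ℕ
      d = length as
      L = polyLipschitz as
      -- The height has to be below `l k` for the nonvanishing. The other two bounds give 12 L W ≤
      -- T^(1 + d) ≤ T^(3 + k) < t (2 + k), as the tail estimate requires.
      k = height as ℕ.⊔ (d ℕ.⊔ 3 ℕ.* (L ℕ.* 4))
      T = t (suc k)
      W = T ℕ.^ d
      y : ℚ
      y = S c (suc k)
      H : ℤ
      H = homogenise as (+ s c (suc k)) (+ T)
      W≢0 : ℕ.NonZero W
      W≢0 = ℕ.m^n≢0 T d
      H≢0 : H ≢ 0ℤ
      H≢0 = homogenise≢0 {l k} (l-prime k) (l∣t k) (l∤s c-digits k) as
        (ℕ.≤-<-trans (ℕ.m≤m⊔n (height as) _) (k<l k)) as≢0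
      ∣p∣≡∣0-p∣ : ∀ p → ∣ p ∣ ≡ ∣ 0ℚ - p ∣
      ∣p∣≡∣0-p∣ p = trans (sym (∣-p∣≡∣p∣ p)) (cong ∣_∣ (sym (+-identityˡ (- p))))
      P→0 : ConvergesTo (λ n → poly as (S c n)) 0ℚ
      P→0 ε 0<ε = ev-map (λ n → subst (λ u → ∣ u - 0ℚ ∣ < ε)
        (trans (seq-evalPoly as (σ {c} c-digits) n) (cong (poly as) (seq-σ c-digits n)))) (evalPoly≈0 ε 0<ε)
      12LW≤t : 3 ℕ.* (L ℕ.* (4 ℕ.* W)) ℕ.≤ t (2 ℕ.+ k)
      12LW≤t = ℕ.≤-trans (ℕ.≤-reflexive (reassoc 3 L 4 W))
        (ℕ.≤-trans (ℕ.*-monoˡ-≤ W 12L≤T)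
        (ℕ.≤-trans (ℕ.^-monoʳ-≤ T (s≤s d≤2+k)) (ℕ.<⇒≤ (t^[2+k]<t[1+k] (suc k)))))
        where
        reassoc : ∀ a b c w → a ℕ.* (b ℕ.* (c ℕ.* w)) ≡ a ℕ.* (b ℕ.* c) ℕ.* w
        reassoc = ℕ.solve-∀
        12L≤T : 3 ℕ.* (L ℕ.* 4) ℕ.≤ T
        12L≤T = ℕ.≤-trans (ℕ.≤-trans (ℕ.m≤n⊔m d _) (ℕ.m≤n⊔m (height as) _))
          (ℕ.≤-trans (ℕ.n≤1+n k) (ℕ.<⇒≤ (k<t (suc k))))
        d≤2+k : d ℕ.≤ 2 ℕ.+ k
        d≤2+k = ℕ.≤-trans (ℕ.≤-trans (ℕ.m≤m⊔n d _) (ℕ.m≤n⊔m (height as) _)) (ℕ.m≤n+m k 2)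
      P≈ : Eventually (λ n → ∣ poly as (S c n) - poly as y ∣ * ⟦ 4 ℕ.* W ⟧ ≤ ⟦ 2 ⟧)
      P≈ = suc k , λ n k<n → (begin
        ∣ poly as (S c n) - poly as y ∣ * ⟦ 4 ℕ.* W ⟧
          ≤⟨ 0≤⇒*-monoʳ-≤ ⟦ 4 ℕ.* W ⟧ (0≤⟦⟧ (4 ℕ.* W))
               (∣poly-poly∣≤ as (∣S∣≤1 c-digits n) (∣S∣≤1 c-digits (suc k))) ⟩
        ⟦ L ⟧ * ∣ S c n - y ∣ * ⟦ 4 ℕ.* W ⟧   ≡⟨ regroup ⟦ L ⟧ ∣ S c n - y ∣ ⟦ 4 ℕ.* W ⟧ ⟩
        ∣ S c n - y ∣ * (⟦ L ⟧ * ⟦ 4 ℕ.* W ⟧) ≡⟨ cong (∣ S c n - y ∣ *_) (⟦⟧-* L (4 ℕ.* W)) ⟨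
        ∣ S c n - y ∣ * ⟦ L ℕ.* (4 ℕ.* W) ⟧   ≤⟨ S-close c-digits k<n (L ℕ.* (4 ℕ.* W)) 12LW≤t ⟩
        1ℚ                                    ≡⟨ ⟦1⟧≡1 ⟨
        ⟦ 1 ⟧                                 ≤⟨ ⟦⟧-mono-≤ (s≤s z≤n) ⟩
        ⟦ 2 ⟧                                 ∎)
        where
        regroup : ∀ a b c → a * b * c ≡ b * (a * c)
        regroup = solve-∀ ℚ-ring

-- Cantor-Bernstein for a subset of a setoid

module CantorBernstein where

  open import Axiom.ExcludedMiddle using (ExcludedMiddle)
  open import Data.Nat.Base using (ℕ; zero; suc)
  open import Data.Product.Base using (Σ; ∃-syntax; _×_; _,_; proj₁; proj₂)
  open import Function.Bundles using (Bijection)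
  open import Level using (0ℓ)
  open import Relation.Binary.Bundles using (Setoid)
  import Relation.Binary.Construct.On as On
  open import Relation.Nullary using (¬_; Dec; yes; no; contradiction)
  open import Relation.Nullary.Decidable using (decidable-stable)

  module _ (em : ExcludedMiddle 0ℓ) (A : Setoid 0ℓ 0ℓ) where

    open Setoid A

    -- Cantor–Bernstein for F and the inclusion of P. Since P need not respect ≈, a chain starts at
    -- an element that is not even equal to a member of P.
    subsetBijection : (P : Carrier → Set) (F : Carrier → Carrier) → (∀ x → P (F x)) →
      (∀ {x y} → x ≈ y → F x ≈ F y) → (∀ {x y} → F x ≈ F y → x ≈ y) →
      Bijection A (On.setoid {B = Σ Carrier P} A proj₁)
    subsetBijection P F F∈P F-cong F-injective = record
      { to        = λ x → h x em
      ; cong      = λ x≈y → h-cong x≈y em em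
      ; bijective = (λ {x} {y} → h-injective x y em em) , h-surjective
      }
      where
      Represented : Carrier → Set
      Represented x = ∃[ y ] y ≈ x × P y

      iterate : ℕ → Carrier → Carrier
      iterate zero    x = x
      iterate (suc n) x = F (iterate n x)

      Chain : Carrier → Set
      Chain x = ∃[ n ] ∃[ a ] ¬ Represented a × x ≈ iterate n a

      chain-resp : ∀ {x y} → x ≈ y → Chain x → Chain y
      chain-resp x≈y (n , a , ¬a , x≈) = n , a , ¬a , trans (sym x≈y) x≈

      chain-F : ∀ {x} → Chain x → Chain (F x)
      chain-F (n , a , ¬a , x≈) = suc n , a , ¬a , F-cong x≈

      represent : ∀ x → ¬ Chain x → Represented x
      represent x ¬chain = decidable-stable em λ ¬x → ¬chain (0 , x , ¬x , refl)

      -- The usual gluing: F on chains, the identity elsewhere. Off the chains x is only equal to a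
      -- member of P, so a representative is chosen. The decision is an argument so that the lemmas
      -- below can split on it.
      h : ∀ x → Dec (Chain x) → Σ Carrier P
      h x (yes _)     = F x , F∈P x
      h x (no ¬chain) = let (y , _ , Py) = represent x ¬chain in y , Py

      h-no : ∀ x ¬chain → proj₁ (h x (no ¬chain)) ≈ x
      h-no x ¬chain = proj₁ (proj₂ (represent x ¬chain))

      h-cong : ∀ {x y} → x ≈ y → ∀ dx dy → proj₁ (h x dx) ≈ proj₁ (h y dy)
      h-cong x≈y (yes _)  (yes _)  = F-cong x≈y
      h-cong x≈y (yes cx) (no ¬cy) = contradiction (chain-resp x≈y cx) ¬cy
      h-cong x≈y (no ¬cx) (yes cy) = contradiction (chain-resp (sym x≈y) cy) ¬cx
      h-cong {x} {y} x≈y (no ¬cx) (no ¬cy) = trans (h-no x ¬cx) (trans x≈y (sym (h-no y ¬cy)))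

      h-injective : ∀ x y dx dy → proj₁ (h x dx) ≈ proj₁ (h y dy) → x ≈ y
      h-injective x y (yes _)  (yes _)  hx≈hy = F-injective hx≈hy
      h-injective x y (yes cx) (no ¬cy) hx≈hy =
        contradiction (chain-resp (trans hx≈hy (h-no y ¬cy)) (chain-F cx)) ¬cy
      h-injective x y (no ¬cx) (yes cy) hx≈hy =
        contradiction (chain-resp (trans (sym hx≈hy) (h-no x ¬cx)) (chain-F cy)) ¬cx
      h-injective x y (no ¬cx) (no ¬cy) hx≈hy = trans (sym (h-no x ¬cx)) (trans hx≈hy (h-no y ¬cy))

      preimage : ∀ s → P s → Dec (Chain s) → ∃[ x ] ∀ d → proj₁ (h x d) ≈ s
      preimage s Ps (no ¬cs) = s , λ
        { (yes cs) → contradiction cs ¬cs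
        ; (no ¬cs) → h-no s ¬cs }
      -- A member of P represents itself, so no chain starts at it; a chain through it therefore has
      -- an earlier element.
      preimage s Ps (yes (zero  , a , ¬a , s≈a)) = contradiction (s , s≈a , Ps) ¬a
      preimage s Ps (yes (suc n , a , ¬a , s≈))  = iterate n a , λ
        { (yes _)  → sym s≈
        ; (no ¬cx) → contradiction (n , a , ¬a , refl) ¬cx }

      h-surjective : ∀ (y : Σ Carrier P) → ∃[ x ] ∀ {z} → z ≈ x → proj₁ (h z em) ≈ proj₁ y
      h-surjective (s , Ps) =
        let (x , hx≈s) = preimage s Ps em in x , λ z≈x → trans (h-cong z≈x em em) (hx≈s em)

-- Coding real numbers by digit sequences

module Cuts where

  open import Axiom.ExcludedMiddle using (ExcludedMiddle)
  open import Data.Integer.Base as ℤ using (ℤ; +_; _⊖_)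
  open import Data.Nat.Base as ℕ using (ℕ; zero; suc)
  import Data.Nat.Properties as ℕ
  open import Data.Product.Base using (∃-syntax; _×_; _,_; proj₁; proj₂)
  open import Data.Rational.Base
  open import Data.Rational.Properties
  open import Data.Sum.Base using (inj₁; inj₂)
  open import Level using (0ℓ)
  open import Relation.Binary.PropositionalEquality
  open import Relation.Nullary using (¬_; Dec; yes; no; contradiction)
  open import Tactic.RingSolver using (solve-∀)
  import Defs as R
  open import Defs using (ℝ; seq; cauchy; fromℚ; _≈_)
  open Arithmetic
  open Rationals
  open Approximation

  -- Cantor's walk along the antidiagonals of the quadrant.
  next : ℕ × ℕ → ℕ × ℕ
  next (zero  , b) = suc b , zero
  next (suc a , b) = a , suc b

  unpair : ℕ → ℕ × ℕ
  unpair zero    = 0 , 0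
  unpair (suc n) = next (unpair n)

  unpair-surjective : ∀ a b → ∃[ n ] unpair n ≡ (a , b)
  unpair-surjective a b = onDiagonal (a ℕ.+ b) b a refl
    where
    onDiagonal : ∀ d b a → a ℕ.+ b ≡ d → ∃[ n ] unpair n ≡ (a , b)
    onDiagonal d       (suc b) a       eq with onDiagonal d b (suc a) (trans (sym (ℕ.+-suc a b)) eq)
    ... | n , unpair≡ = suc n , cong next unpair≡
    onDiagonal d       zero    zero    eq = 0 , refl
    onDiagonal (suc d) zero    (suc a) eq with onDiagonal d d 0 refl
    ... | n , unpair≡ = suc n , trans (cong next unpair≡)
      (cong (λ k → k , 0) (sym (trans (sym (ℕ.+-identityʳ (suc a))) eq)))

  -- A number encodes a, b and d, read as (a - b) / (1 + d); the difference covers both signs.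
  enumerate : ℕ → ℚ
  enumerate n = (proj₁ (unpair (proj₁ (unpair n))) ⊖ proj₂ (unpair (proj₁ (unpair n)))) / suc (proj₂ (unpair n))

  enumerate-surjective : ∀ p → ∃[ n ] enumerate n ≡ p
  enumerate-surjective p@(mkℚ i d _) = fromPair i refl
    where
    fraction : ∀ a b → a ⊖ b ≡ i → ∃[ n ] enumerate n ≡ p
    fraction a b a⊖b≡i with unpair-surjective a b
    ... | j , j≡ with unpair-surjective j d
    ... | n , n≡ = n , trans
      (cong₂ (λ u v → (proj₁ (unpair u) ⊖ proj₂ (unpair u)) / suc v)
        (cong proj₁ n≡) (cong proj₂ n≡))
      (trans (cong (λ u → (proj₁ u ⊖ proj₂ u) / suc d) j≡)
        (trans (cong (λ u → u / suc d) a⊖b≡i) (↥p/↧p≡p p)))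
    fromPair : ∀ k → k ≡ i → ∃[ n ] enumerate n ≡ p
    fromPair (+ a)      eq = fraction a 0 eq
    fromPair ℤ.-[1+ a ] eq = fraction 0 (suc a) eq

  ½+½ : ∀ ε → ½ * ε + ½ * ε ≡ ε
  ½+½ ε = trans (sym (*-distribʳ-+ ε ½ ½)) (*-identityˡ ε)

  0<½* : ∀ {ε} → 0ℚ < ε → 0ℚ < ½ * ε
  0<½* {ε} 0<ε = positive⁻¹ _ {{pos*pos⇒pos ½ ε {{positive 0<ε}}}}

  ∣p-q∣<⇒p<+q : ∀ {p q ε} → ∣ p - q ∣ < ε → p < ε + q
  ∣p-q∣<⇒p<+q {p} {q} {ε} ∣p-q∣<ε = subst (_< ε + q) (cancel p q)
    (+-monoˡ-< q (≤-<-trans (p≤∣p∣ (p - q)) ∣p-q∣<ε))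
    where
    cancel : ∀ p q → (p - q) + q ≡ p
    cancel = solve-∀ ℚ-ring

  ∣p-q∣< : ∀ {p q ε} → p < ε + q → q < ε + p → ∣ p - q ∣ < ε
  ∣p-q∣< {p} {q} {ε} p<ε+q q<ε+p with ∣p∣≡p∨∣p∣≡-p (p - q)
  ... | inj₁ eq = subst (_< ε) (sym eq) (+-cancelˡ-< q (subst₂ _<_ (lhs p q) (+-comm ε q) p<ε+q))
    where
    lhs : ∀ p q → p ≡ q + (p - q)
    lhs = solve-∀ ℚ-ring
  ... | inj₂ eq = subst (_< ε) (sym eq) (+-cancelˡ-< p (subst₂ _<_ (lhs p q) (+-comm ε p) q<ε+p))
    where
    lhs : ∀ p q → q ≡ p + - (p - q)
    lhs = solve-∀ ℚ-ring

  <-respʳ-≈ : ∀ q x y → x ≈ y → R._<_ (fromℚ q) x → R._<_ (fromℚ q) y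
  <-respʳ-≈ q x y x≈y (ε , 0<ε , ev) = ½ * ε , 0<½* 0<ε , ev-zip
    (λ n q+ε<x x≈y → +-cancelˡ-< (½ * ε) (<-trans (subst (_< seq x n) (regroup n) q+ε<x) (∣p-q∣<⇒p<+q x≈y)))
    ev (x≈y (½ * ε) (0<½* 0<ε))
    where
    regroup : ∀ (n : ℕ) → q + ε ≡ ½ * ε + (q + ½ * ε)
    regroup _ = trans (cong (λ u → q + u) (sym (½+½ ε))) (swap q (½ * ε))
      where
      swap : ∀ q a → q + (a + a) ≡ a + (q + a)
      swap = solve-∀ ℚ-ring

  -- If x exceeded y by ε at a late index, a rational midway between the two terms would lie in the
  -- cut of x but not in that of y.
  cut⊆⇒≤ : ∀ x y → (∀ q → R._<_ (fromℚ q) x → R._<_ (fromℚ q) y) →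
    ∀ ε → 0ℚ < ε → Eventually (λ n → seq x n < ε + seq y n)
  cut⊆⇒≤ x y cut⊆ ε 0<ε = N , λ n N≤n → ≰⇒> λ ε+y≤x → contradict n N≤n ε+y≤x
    where
    η δ : ℚ
    η = ½ * ε
    δ = ½ * η
    0<δ : 0ℚ < δ
    0<δ = 0<½* (0<½* 0<ε)
    N₁ N₂ N : ℕ
    N₁ = proj₁ (cauchy x δ 0<δ)
    N₂ = proj₁ (cauchy y δ 0<δ)
    N  = N₁ ℕ.⊔ N₂
    closeˣ : ∀ m n → N ℕ.≤ m → N ℕ.≤ n → ∣ seq x m - seq x n ∣ < δ
    closeˣ m n N≤m N≤n = proj₂ (cauchy x δ 0<δ) m n (ℕ.m⊔n≤o⇒m≤o N₁ N₂ N≤m) (ℕ.m⊔n≤o⇒m≤o N₁ N₂ N≤n)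
    closeʸ : ∀ m n → N ℕ.≤ m → N ℕ.≤ n → ∣ seq y m - seq y n ∣ < δ
    closeʸ m n N≤m N≤n = proj₂ (cauchy y δ 0<δ) m n (ℕ.m⊔n≤o⇒n≤o N₁ N₂ N≤m) (ℕ.m⊔n≤o⇒n≤o N₁ N₂ N≤n)
    ε≡4δ : ε ≡ (δ + δ) + (δ + δ)
    ε≡4δ = sym (trans (cong₂ _+_ (½+½ η) (½+½ η)) (½+½ ε))
    contradict : ∀ n → N ℕ.≤ n → ¬ ε + seq y n ≤ seq x n
    contradict n N≤n ε+y≤x = absurd (cut⊆ q (δ , 0<δ , N , q+δ<x))
      where
      open ≤-Reasoning
      q : ℚ
      -- With δ = ε / 4 there is 2 δ of room on either side of q: one δ for the oscillation of the
      -- sequence, the other for a strict gap.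
      q = (δ + δ) + seq y n
      q+δ<x : ∀ m → N ℕ.≤ m → q + δ < seq x m
      q+δ<x m N≤m = +-cancelˡ-< δ (begin-strict
        δ + ((δ + δ + seq y n) + δ)     ≡⟨ regroup δ (seq y n) ⟩
        ((δ + δ) + (δ + δ)) + seq y n   ≡⟨ cong (_+ seq y n) ε≡4δ ⟨
        ε + seq y n                     ≤⟨ ε+y≤x ⟩
        seq x n                         <⟨ ∣p-q∣<⇒p<+q (closeˣ n m N≤n N≤m) ⟩
        δ + seq x m                     ∎)
        where
        regroup : ∀ d y → d + ((d + d + y) + d) ≡ ((d + d) + (d + d)) + y
        regroup = solve-∀ ℚ-ring
      absurd : ¬ R._<_ (fromℚ q) y
      absurd (ε' , 0<ε' , M , q+ε'<y) = <-irrefl refl (begin-strict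
        seq y m                   <⟨ ∣p-q∣<⇒p<+q (closeʸ m n (ℕ.m≤m⊔n N M) N≤n) ⟩
        δ + seq y n               <⟨ +-monoˡ-< (seq y n) (p<p+q {δ} 0<δ) ⟩
        q                         <⟨ p<p+q {q} 0<ε' ⟩
        q + ε'                    <⟨ q+ε'<y m (ℕ.m≤n⊔m N M) ⟩
        seq y m                   ∎)
        where
        m : ℕ
        m = N ℕ.⊔ M

  cut-injective : ∀ x y → (∀ q → R._<_ (fromℚ q) x → R._<_ (fromℚ q) y) →
    (∀ q → R._<_ (fromℚ q) y → R._<_ (fromℚ q) x) → x ≈ y
  cut-injective x y x⊆y y⊆x ε 0<ε =
    ev-zip (λ n → ∣p-q∣<) (cut⊆⇒≤ x y x⊆y ε 0<ε) (cut⊆⇒≤ y x y⊆x ε 0<ε)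

  digit : ∀ {A : Set} → Dec A → ℕ
  digit (yes _) = 2
  digit (no _)  = 1

  digit-isDigit : ∀ {A : Set} (d : Dec A) → IsDigit (digit d)
  digit-isDigit (yes _) = inj₂ refl
  digit-isDigit (no _)  = inj₁ refl

  digit-cong : ∀ {A B : Set} → (A → B) → (B → A) → (d : Dec A) (e : Dec B) → digit d ≡ digit e
  digit-cong f g (yes _) (yes _) = refl
  digit-cong f g (yes a) (no ¬b) = contradiction (f a) ¬b
  digit-cong f g (no ¬a) (yes b) = contradiction (g b) ¬a
  digit-cong f g (no _)  (no _)  = refl

  digit-injective : ∀ {A B : Set} (d : Dec A) (e : Dec B) → digit d ≡ digit e → A → B
  digit-injective d       (yes b) _  _ = b
  digit-injective (no ¬a) (no _)  _  a = contradiction a ¬a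

  module _ (em : ExcludedMiddle 0ℓ) where

    cutDigits : ℝ → ℕ → ℕ
    cutDigits x k = digit (em {R._<_ (fromℚ (enumerate k)) x})

    cutDigits-isDigit : ∀ x k → IsDigit (cutDigits x k)
    cutDigits-isDigit x k = digit-isDigit (em {R._<_ (fromℚ (enumerate k)) x})

    cutDigits-cong : ∀ x y → x ≈ y → ∀ k → cutDigits x k ≡ cutDigits y k
    cutDigits-cong x y x≈y k = digit-cong
      (<-respʳ-≈ (enumerate k) x y x≈y)
      (<-respʳ-≈ (enumerate k) y x (R.≈-sym {x} {y} x≈y)) em em

    cutDigits-injective : ∀ x y → (∀ k → cutDigits x k ≡ cutDigits y k) → x ≈ y
    cutDigits-injective x y eq = cut-injective x y (transfer x y eq) (transfer y x (λ k → sym (eq k)))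
      where
      transfer : ∀ x y → (∀ k → cutDigits x k ≡ cutDigits y k) →
        ∀ q → R._<_ (fromℚ q) x → R._<_ (fromℚ q) y
      transfer x y eq q with enumerate-surjective q
      ... | k , refl = digit-injective em em (eq k)

-- Distinct digit sequences give distinct σ; positivity

module Injectivity where

  open import Data.Nat.Base as ℕ using (ℕ; zero; suc)
  import Data.Nat.Properties as ℕ
  open import Data.Product.Base using (∃-syntax; _,_)
  open import Data.Rational.Base
  open import Data.Rational.Properties
  open import Data.Sum.Base using (inj₁; inj₂)
  open import Relation.Binary.PropositionalEquality
  open import Relation.Nullary using (¬_; contradiction)
  open import Tactic.RingSolver using (solve-∀)
  import Defs as R
  open import Defs using (seq; _≈_; 0ℝ)
  open Arithmetic
  open Rationals
  open Series
  open Approximation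

  module _ {c d : ℕ → ℕ} (c-digits : ∀ k → IsDigit (c k)) (d-digits : ∀ k → IsDigit (d k)) where

    -- The larger digit is ahead by 1 / t (1 + k), at least 8 / t (2 + k), while the remaining terms
    -- of the other series recover at most 3 / t (2 + k). A gap of at least 1 / t (2 + k) stays for
    -- good.
    smallerDigit : ∀ {k} → S c k ≡ S d k → c k ≡ 1 → d k ≡ 2 →
      ∀ n → suc k ℕ.≤ n → S c n + r (2 ℕ.+ k) ≤ S d n
    smallerDigit {k} Sc≡Sd c≡1 d≡2 n k<n = begin
      S c n + r″                                 ≡⟨ split (S c n) (S c (suc k)) r″ ⟩
      (S c n - S c (suc k)) + (S c (suc k) + r″) ≤⟨ +-monoˡ-≤ (S c (suc k) + r″) (S-S≤3r c-digits k<n) ⟩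
      ⟦ 3 ⟧ * r″ + (S c (suc k) + r″)            ≡⟨ collect (S c (suc k)) ⟩
      ⟦ 4 ⟧ * r″ + S c (suc k)                   ≤⟨ +-monoˡ-≤ (S c (suc k)) (≤-trans
        (0≤⇒*-monoʳ-≤ r″ (0≤r (2 ℕ.+ k)) (⟦⟧-mono-≤ {4} {8} (ℕ.m≤m+n 4 4))) (8r≤r (suc k))) ⟩
      r′ + S c (suc k)
        ≡⟨ cong (λ u → r′ + u) (trans (S-suc′ c k) (cong (λ u → ⟦ u ⟧ * r′ + S c k) c≡1)) ⟩
      r′ + (⟦ 1 ⟧ * r′ + S c k)                  ≡⟨ cong (λ u → r′ + (u * r′ + S c k)) ⟦1⟧≡1 ⟩
      r′ + (1ℚ * r′ + S c k)                     ≡⟨ double r′ (S c k) ⟩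
      (1ℚ + 1ℚ) * r′ + S c k                     ≡⟨ cong₂ (λ u v → u * r′ + v) 1+1≡⟦2⟧ Sc≡Sd ⟩
      ⟦ 2 ⟧ * r′ + S d k
        ≡⟨ trans (S-suc′ d k) (cong (λ u → ⟦ u ⟧ * r′ + S d k) d≡2) ⟨
      S d (suc k)                                ≤⟨ S-mono-≤ d-digits k<n ⟩
      S d n                                      ∎
      where
      open ≤-Reasoning
      r′ r″ : ℚ
      r′ = r (suc k)
      r″ = r (2 ℕ.+ k)
      split : ∀ a b x → a + x ≡ (a - b) + (b + x)
      split = solve-∀ ℚ-ring
      double : ∀ x y → x + (1ℚ * x + y) ≡ (1ℚ + 1ℚ) * x + y
      double = solve-∀ ℚ-ring
      collect : ∀ b → ⟦ 3 ⟧ * r″ + (b + r″) ≡ ⟦ 4 ⟧ * r″ + b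
      collect b = trans (lemma ⟦ 3 ⟧ r″ b)
        (cong (λ u → u * r″ + b) (sym (trans (⟦⟧-+ 1 3) (cong (_+ ⟦ 3 ⟧) ⟦1⟧≡1))))
        where
        lemma : ∀ a x y → a * x + (y + x) ≡ (1ℚ + a) * x + y
        lemma = solve-∀ ℚ-ring

    smallerDigit-apart : ∀ {k} → S c k ≡ S d k → c k ≡ 1 → d k ≡ 2 →
      ¬ Eventually (λ n → ∣ S c n - S d n ∣ < r (2 ℕ.+ k))
    smallerDigit-apart {k} Sc≡Sd c≡1 d≡2 close = ev-extract (ev-zip
      (λ n gap close → <-irrefl refl (<-≤-trans close (bound n gap)))
      (suc k , smallerDigit Sc≡Sd c≡1 d≡2) close)
      where
      open ≤-Reasoning
      bound : ∀ n → S c n + r (2 ℕ.+ k) ≤ S d n → r (2 ℕ.+ k) ≤ ∣ S c n - S d n ∣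
      bound n gap = begin
        r (2 ℕ.+ k)                            ≡⟨ cancel (S c n) (r (2 ℕ.+ k)) ⟩
        (S c n + r (2 ℕ.+ k)) - S c n          ≤⟨ +-monoˡ-≤ (- S c n) gap ⟩
        S d n - S c n                          ≤⟨ p≤∣p∣ (S d n - S c n) ⟩
        ∣ S d n - S c n ∣                      ≡⟨ ∣p-q∣≡∣q-p∣ (S d n) (S c n) ⟩
        ∣ S c n - S d n ∣                      ∎
        where
        cancel : ∀ a x → x ≡ (a + x) - a
        cancel = solve-∀ ℚ-ring

  digits-injective : ∀ {c d} (c-digits : ∀ k → IsDigit (c k)) (d-digits : ∀ k → IsDigit (d k)) →
    (∀ ε → 0ℚ < ε → Eventually (λ n → ∣ S c n - S d n ∣ < ε)) → ∀ k → c k ≡ d k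
  digits-injective {c} {d} c-digits d-digits close k = sameDigit k (sameSum k)
    where
    sameDigit : ∀ k → S c k ≡ S d k → c k ≡ d k
    sameDigit k Sc≡Sd with c-digits k | d-digits k
    ... | inj₁ c≡1 | inj₁ d≡1 = trans c≡1 (sym d≡1)
    ... | inj₂ c≡2 | inj₂ d≡2 = trans c≡2 (sym d≡2)
    ... | inj₁ c≡1 | inj₂ d≡2 = contradiction (close (r (2 ℕ.+ k)) (0<r (2 ℕ.+ k)))
      (smallerDigit-apart c-digits d-digits Sc≡Sd c≡1 d≡2)
    ... | inj₂ c≡2 | inj₁ d≡1 = contradiction
      (ev-map (λ n → subst (_< r (2 ℕ.+ k)) (∣p-q∣≡∣q-p∣ (S c n) (S d n))) (close (r (2 ℕ.+ k)) (0<r (2 ℕ.+ k))))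
      (smallerDigit-apart d-digits c-digits (sym Sc≡Sd) d≡1 c≡2)
    -- Agreement of sums and of digits is proved by mutual recursion: equal sums at k reduce a
    -- disagreement at k to a first difference.
    sameSum : ∀ k → S c k ≡ S d k
    sameSum zero    = trans (S-zero c) (sym (S-zero d))
    sameSum (suc k) = trans (S-suc′ c k) (trans
      (cong₂ (λ u v → ⟦ u ⟧ * r (suc k) + v) (sameDigit k (sameSum k)) (sameSum k))
      (sym (S-suc′ d k)))

  σ-cong : ∀ {c d} (c-digits : ∀ k → IsDigit (c k)) (d-digits : ∀ k → IsDigit (d k)) →
    (∀ k → c k ≡ d k) → σ {c} c-digits ≈ σ {d} d-digits
  σ-cong {c} {d} c-digits d-digits c≗d ε 0<ε = 0 , λ n _ → subst (_< ε) (sym (zeroDifference n)) 0<ε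
    where
    zeroDifference : ∀ n → ∣ seq (σ {c} c-digits) n - seq (σ {d} d-digits) n ∣ ≡ 0ℚ
    zeroDifference n = trans
      (cong₂ (λ u v → ∣ u - v ∣) (trans (seq-σ c-digits n) (S-cong c≗d n)) (seq-σ d-digits n))
      (cong ∣_∣ (+-inverseʳ (S d n)))

  σ-injective : ∀ {c d} (c-digits : ∀ k → IsDigit (c k)) (d-digits : ∀ k → IsDigit (d k)) →
    σ {c} c-digits ≈ σ {d} d-digits → ∀ k → c k ≡ d k
  σ-injective {c} {d} c-digits d-digits σ≈σ = digits-injective c-digits d-digits λ ε 0<ε →
    ev-map (λ n → subst₂ (λ u v → ∣ u - v ∣ < ε) (seq-σ c-digits n) (seq-σ d-digits n)) (σ≈σ ε 0<ε)

  σ-positive : ∀ {c} (c-digits : ∀ k → IsDigit (c k)) → R._<_ 0ℝ (σ {c} c-digits)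
  -- The gap is the first nonzero sum. It has to be exceeded strictly, so the bound starts at index
  -- 2.
  σ-positive {c} c-digits = S c 1 , 0<S₁ , 2 , λ n 2≤n →
    subst₂ _<_ (sym (+-identityˡ (S c 1))) (sym (seq-σ c-digits n))
      (<-≤-trans (S<S 1) (S-mono-≤ c-digits 2≤n))
    where
    S<S : ∀ k → S c k < S c (suc k)
    S<S k = subst₂ _<_ (+-identityˡ (S c k)) (sym (S-suc′ c k)) (+-monoˡ-< (S c k) 0<cr)
      where
      0<cr : 0ℚ < ⟦ c k ⟧ * r (suc k)
      0<cr = positive⁻¹ (⟦ c k ⟧ * r (suc k)) {{pos*pos⇒pos
        ⟦ c k ⟧ {{⟦⟧-pos (c k) {{ℕ.>-nonZero (digit>0 (c-digits k))}}}} (r (suc k)) {{positive (0<r (suc k))}}}}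
    0<S₁ : 0ℚ < S c 1
    0<S₁ = subst (_< S c 1) (S-zero c) (S<S 0)

-- The injection of the reals into the set of suitable σ

open import Axiom.ExcludedMiddle using (ExcludedMiddle)
open import Data.Nat.Base using (ℕ; _≤_)
open import Data.Product.Base using (_×_; _,_)
open import Level using (0ℓ)
open import Defs

theorem1p5 : ExcludedMiddle 0ℓ →
    ContinuumMany (λ σ →
    0ℝ < σ × Transcendental σ ×
    (∀ (m : ℕ) → 2 ≤ m → ∀ (ξ : ℝ) → Liouville ξ → Liouville (σ * ξ ^ m)))
theorem1p5 em = subsetBijection em ℝ-setoid _ F
  (λ x → σ-positive (isDigit x) , σ-transcendental (isDigit x) , σξ^m-liouville (isDigit x) em)
  (λ {x} {y} x≈y → σ-cong (isDigit x) (isDigit y) (cutDigits-cong em x y x≈y))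
  (λ {x} {y} Fx≈Fy → cutDigits-injective em x y (σ-injective (isDigit x) (isDigit y) Fx≈Fy))
  where
  open Arithmetic using (IsDigit)
  open Series using (σ)
  open Products using (σξ^m-liouville)
  open Transcendence using (σ-transcendental)
  open CantorBernstein using (subsetBijection)
  open Cuts using (cutDigits; cutDigits-isDigit; cutDigits-cong; cutDigits-injective)
  open Injectivity using (σ-positive; σ-cong; σ-injective)
  isDigit : ∀ x k → IsDigit (cutDigits em x k)
  isDigit = cutDigits-isDigit em
  F : ℝ → ℝ
  F x = σ {cutDigits em x} (isDigit x)
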